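{- Let $G_\bullet$ be a finitely generated $\mathrm{FI}$-graph such that $G_n$ is not bipartite for all sufficiently large $n$. Then the weighted walk on $G_n$ has mixing time which is constant in $n$: for every $\varepsilon>0$ there exist $T$ and $N$ such that for all $n>N$ the mixing time $t_{\mathrm{mix}}(\varepsilon)$ of the weighted walk on $G_n$ is at most $T$.
   Context: $\mathrm{FI}$ denotes the category of the sets $[n]=\{1,\dots,n\}$ and injections. An $\mathrm{FI}$-graph $G_\bullet$ is a functor from $\mathrm{FI}$ to graphs (finite vertex set, edges are $2$-subsets of vertices or loops) and graph homomorphisms; $G_n$ is its value on $[n]$, and the symmetric group $\mathfrak{S}_n$ acts on $G_n$ by graph automorphisms. It is finitely generated if for some $d$ and all $n\ge d$ every vertex of $G_{n+1}$ is in the image of $G(f)$ for some injection $f:[n]\hookrightarrow[n+1]$. All graphs are assumed connected. An edge orbit of $G_n$ is an $\mathfrak{S}_n$-orbit of edges. The weighted walk on $G_n$: from the current vertex $v$, choose uniformly at random one of the edge orbits that contain an edge incident to $v$, then choose uniformly at random an edge incident to $v$ from that orbit, and move along it. For an irreducible aperiodic Markov chain with stationary distribution $\pi$, $t_{\mathrm{mix}}(\varepsilon)$ is the smallest $t$ such that from every starting state the distribution after $t$ steps is within total variation distance $\varepsilon$ of $\pi$ (total variation distance between $\mu,\nu$ is $\frac12\sum_x|\mu(x)-\nu(x)|$). -}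

module Defs where

open import Data.Bool using (Bool; true; false; if_then_else_)
open import Data.Nat as ℕ using (ℕ; zero; suc; _≤_; _<_)
open import Data.Fin using (Fin; zero; suc; _≟_)
open import Data.Fin.Properties using (any?; all?)
open import Data.Vec using (Vec; []; _∷_; lookup)
open import Data.Product using (Σ; ∃; _×_; _,_; proj₁; proj₂)
open import Data.Sum using (_⊎_; inj₁; inj₂)
open import Data.Integer using (+_)
open import Data.Rational as ℚ using (ℚ; 0ℚ; 1ℚ; _+_; _-_; _*_; ∣_∣)
open import Function using (_∘_; id)
open import Function.Definitions using (Injective)
open import Relation.Binary.PropositionalEquality using (_≡_; _≢_; refl)
open import Relation.Binary.Construct.Closure.ReflexiveTransitive using (Star)
open import Relation.Nullary using (Dec; yes; no; ¬_; does)
open import Relation.Nullary.Decidable using (map′; _×-dec_; _⊎-dec_; _→-dec_)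
open import Relation.Unary using (Decidable)

-- Finite graphs: vertex set Fin V, edges are unordered pairs {v,w}
-- (possibly loops v = w) encoded by a symmetric Boolean adjacency.

record Graph : Set where
  field
    V     : ℕ
    adj   : Fin V → Fin V → Bool
    adj-sym : ∀ v w → adj v w ≡ adj w v
open Graph public

Edge : (G : Graph) → Fin (V G) → Fin (V G) → Set
Edge G v w = adj G v w ≡ true

Connected : Graph → Set
Connected G = ∀ v w → Star (Edge G) v w

Bipartite : Graph → Set
Bipartite G = ∃ λ (c : Fin (V G) → Bool) → ∀ v w → Edge G v w → c v ≢ c w

record FIGraph : Set where
  field
    G    : ℕ → Graph
    map  : ∀ {m n} (f : Fin m → Fin n) → .(Injective _≡_ _≡_ f) →
           Fin (V (G m)) → Fin (V (G n))
    map-hom : ∀ {m n} (f : Fin m → Fin n) .(inj : Injective _≡_ _≡_ f) →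
              ∀ v w → Edge (G m) v w → Edge (G n) (map f inj v) (map f inj w)
    -- well defined on injections as set maps
    map-cong : ∀ {m n} (f g : Fin m → Fin n)
               .(inj₁ : Injective _≡_ _≡_ f) .(inj₂ : Injective _≡_ _≡_ g) →
               (∀ x → f x ≡ g x) → ∀ v → map f inj₁ v ≡ map g inj₂ v
    map-id : ∀ {n} .(inj : Injective _≡_ _≡_ (id {A = Fin n})) →
             ∀ v → map id inj v ≡ v
    map-∘  : ∀ {l m n} (f : Fin l → Fin m) (g : Fin m → Fin n)
             .(injf : Injective _≡_ _≡_ f) .(injg : Injective _≡_ _≡_ g)
             .(injgf : Injective _≡_ _≡_ (g ∘ f)) →
             ∀ v → map (g ∘ f) injgf v ≡ map g injg (map f injf v)
open FIGraph public

FinitelyGenerated : FIGraph → Set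
FinitelyGenerated Γ =
  ∃ λ d → ∀ n → d ≤ n → ∀ (v : Fin (V (G Γ (suc n)))) →
    ∃ λ (f : Fin n → Fin (suc n)) → Σ (Injective _≡_ _≡_ f) λ inj →
      ∃ λ u → map Γ f inj u ≡ v

-- Edge orbits under 𝔖ₙ. A permutation σ of [n] is given by its list of
-- images (a vector σ with lookup σ injective).

MapsEdge : (Γ : FIGraph) {n : ℕ} (σ : Fin n → Fin n) → .(Injective _≡_ _≡_ σ) →
           (a b c d : Fin (V (G Γ n))) → Set
MapsEdge Γ σ inj a b c d =
  (map Γ σ inj a ≡ c × map Γ σ inj b ≡ d) ⊎ (map Γ σ inj a ≡ d × map Γ σ inj b ≡ c)

SameOrbit : (Γ : FIGraph) (n : ℕ) (a b c d : Fin (V (G Γ n))) → Set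
SameOrbit Γ n a b c d =
  ∃ λ (σ : Vec (Fin n) n) → Σ (Injective _≡_ _≡_ (lookup σ)) λ inj →
    MapsEdge Γ (lookup σ) inj a b c d

private
  exVec? : ∀ {n} k {P : Vec (Fin n) k → Set} → (∀ v → Dec (P v)) → Dec (∃ P)
  exVec? zero P? = map′ (λ p → [] , p) (λ { ([] , p) → p }) (P? [])
  exVec? (suc k) {P} P? =
    map′ (λ { (i , v , p) → (i ∷ v) , p }) (λ { ((i ∷ v) , p) → i , v , p })
         (any? λ i → exVec? k (λ v → P? (i ∷ v)))

  inj? : ∀ {n} (f : Fin n → Fin n) → Dec (Injective _≡_ _≡_ f)
  inj? f = map′ (λ h {x} {y} → h x y) (λ h x y → h)
                (all? λ x → all? λ y → (f x ≟ f y) →-dec (x ≟ y))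

sameOrbit? : (Γ : FIGraph) (n : ℕ) (a b c d : Fin (V (G Γ n))) → Dec (SameOrbit Γ n a b c d)
sameOrbit? Γ n a b c d = exVec? n P?
  where
  P? : ∀ σ → Dec (Σ (Injective _≡_ _≡_ (lookup σ)) λ inj → MapsEdge Γ (lookup σ) inj a b c d)
  P? σ with inj? (lookup σ)
  ... | no ¬i = no (λ p → ¬i (proj₁ p))
  ... | yes i = map′ (λ q → i , q) (λ p → proj₂ p)
                  (((map Γ (lookup σ) i a ≟ c) ×-dec (map Γ (lookup σ) i b ≟ d)) ⊎-dec
                   ((map Γ (lookup σ) i a ≟ d) ×-dec (map Γ (lookup σ) i b ≟ c)))

count : ∀ k → (Fin k → Bool) → ℕ
count zero p = 0
count (suc k) p = (if p zero then 1 else 0) ℕ.+ count k (p ∘ suc)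

sumℚ : ∀ k → (Fin k → ℚ) → ℚ
sumℚ zero f = 0ℚ
sumℚ (suc k) f = f zero + sumℚ k (f ∘ suc)

-- 1/m (with the junk value 0 for m = 0, never used below)
recip : ℕ → ℚ
recip zero = 0ℚ
recip (suc m) = + 1 ℚ./ suc m

-- The weighted walk on Gₙ.
-- Edges incident to v correspond to neighbours u of v (the edge {v,u}).

module _ (Γ : FIGraph) (n : ℕ) where
  private
    Gn = G Γ n
    k  = V Gn

  orbitDegree : Fin k → Fin k → ℕ
  orbitDegree v w = count k λ u → adj Gn v u Data.Bool.∧ does (sameOrbit? Γ n v u v w)
    where import Data.Bool

  -- number of edge orbits containing an edge incident to v:
  -- count the neighbours u that are the first (in the order of Fin k)
  -- representative of their orbit among the edges incident to v
  orbitsAt : Fin k → ℕ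
  orbitsAt v = count k λ u → adj Gn v u ∧
                 not (does (any? λ (u' : Fin k) →
                        (u' Data.Fin.<? u) ×-dec (adj Gn v u' Data.Bool.≟ true)
                          ×-dec sameOrbit? Γ n v u' v u))
    where open import Data.Bool using (_∧_; not)
          import Data.Fin
          import Data.Bool

  -- transition probability v → w : choose an orbit uniformly among
  -- those incident to v, then an edge of it incident to v uniformly
  walkP : Fin k → Fin k → ℚ
  walkP v w = if adj Gn v w then recip (orbitsAt v) * recip (orbitDegree v w) else 0ℚ

  step : (Fin k → ℚ) → (Fin k → ℚ)
  step μ x = sumℚ k λ y → μ y * walkP y x

  distAfter : ℕ → Fin k → (Fin k → ℚ)
  distAfter zero v x = if does (x ≟ v) then 1ℚ else 0ℚ
  distAfter (suc t) v = step (distAfter t v)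

  Stationary : (Fin k → ℚ) → Set
  Stationary π = (∀ x → 0ℚ ℚ.≤ π x) × sumℚ k π ≡ 1ℚ × (∀ x → step π x ≡ π x)

  tvDist : (Fin k → ℚ) → (Fin k → ℚ) → ℚ
  tvDist μ ν = ℚ.½ * sumℚ k λ x → ∣ μ x - ν x ∣

  -- t_mix(ε) ≤ T : some t ≤ T works from every starting vertex
  -- (the mixing time is the least such t)
  MixingTimeAtMost : ℚ → (Fin k → ℚ) → ℕ → Set
  MixingTimeAtMost ε π T = ∃ λ t → t ≤ T × ∀ v → tvDist (distAfter t v) π ℚ.≤ ε

{-# OPTIONS --safe #-}

-- Every vertex of Gₙ is supported on at most d points of [n], so any two vertices lie in the image
-- of G_N for one fixed N. This bounds the number of edge orbits and, since G_N is connected and not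
-- bipartite, joins any two vertices by a walk of one fixed length. Given v and v′, let X be the
-- union of their supports and let x₀ be a vertex supported off X. A walk from v to x₀ that at each
-- step replaces its next edge by a random one of the same orbit still ends, with probability bounded
-- below, at a translate of x₀ supported off X: the stabiliser H of a vertex preserves a core of at
-- most d points and contains all transpositions off the core, so boundedly many elements of H suffice
-- to move any H-translate of the support of the target off X again. The translates of x₀ off X form
-- one orbit of the permutations fixing v and v′, so the laws of the walks from v and from v′ are both
-- constant on them, hence overlap by a constant, and Doeblin's argument applies.

module Submission where

open import Defs
open import Algebra.Bundles using (module CommutativeRing)
open import Data.Bool using (Bool; true; false; if_then_else_; _∧_; not; _xor_)
import Data.Bool as Bool
open import Data.Fin using (Fin; zero; suc; punchIn; punchOut; combine; finToFun; funToFin)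
import Data.Fin as Fin
open import Data.Fin.Permutation as Perm using (Permutation′; permutation; _⟨$⟩ʳ_; _⟨$⟩ˡ_; _∘ₚ_; flip; transpose; inverseˡ; inverseʳ)
import Data.Fin.Permutation.Components as PC
open import Data.Fin.Properties using (_≟_; any?; all?; punchOut-injective; punchIn-injective; punchIn-punchOut; combine-injective; injective⇒≤; finToFun-funToFin; suc-injective; 0≢1+n; <-cmp)
import Data.Integer as ℤ
import Data.Integer.Properties as ℤₚ
open import Data.List using (List; []; _∷_; length; _++_; cartesianProductWith)
import Data.List as List
import Data.List.Properties as List
open import Data.List.Membership.DecPropositional using (_∈?_)
open import Data.List.Membership.Propositional using (_∈_; _∉_)
open import Data.List.Membership.Propositional.Properties using (∈-tabulate⁺; ∈-++⁺ˡ; ∈-++⁺ʳ; ∈-cartesianProductWith⁺)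
open import Data.List.Relation.Unary.Any using (here; there; index)
open import Data.List.Relation.Unary.Any.Properties using (lookup-index)
open import Data.Nat using (ℕ; zero; suc; _≤_; _<_; z≤n; s≤s; _≤′_; ≤′-refl; ≤′-step)
import Data.Nat as ℕ
import Data.Nat.Properties as ℕₚ
import Data.Nat.Solver as ℕSolver
open import Data.Product using (Σ; ∃; _×_; _,_; proj₁; proj₂)
open import Data.Rational using (ℚ; 0ℚ; 1ℚ; _+_; _-_; _*_; -_; ∣_∣; mkℚ)
import Data.Rational as ℚ
import Data.Rational.Properties as ℚₚ
import Data.Rational.Solver as ℚSolver
open import Data.Rational.Unnormalised as ℚᵘ using (mkℚᵘ)
import Data.Rational.Unnormalised.Properties as ℚᵘₚ
open import Data.Sum using (_⊎_; inj₁; inj₂)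
open import Data.Vec using (lookup; tabulate)
open import Data.Vec.Properties using (lookup∘tabulate)
open import Function using (_∘_; id)
open import Function.Definitions using (Injective)
open import Relation.Binary.Construct.Closure.ReflexiveTransitive as Star using (Star; _◅_)
open import Relation.Binary.Definitions using (tri<; tri≈; tri>)
open import Relation.Binary.PropositionalEquality using (_≡_; _≢_; refl; sym; trans; cong; cong₂; subst; subst₂; module ≡-Reasoning)
open import Relation.Nullary using (Dec; yes; no; ¬_; does; contradiction)
open import Relation.Nullary.Decidable using (map′; _×-dec_; _→-dec_; ¬?; dec-true; dec-false; decidable-stable; toWitness)
import Algebra.Properties.CommutativeMonoid.Sum ℕₚ.+-0-commutativeMonoid as Σℕ
import Algebra.Properties.Semiring.Sum (CommutativeRing.semiring ℚₚ.+-*-commutativeRing) as Σℚ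

-- The overlap of two laws cannot be sought at a single vertex: the number of vertices may grow with
-- `n`, and single probabilities may then tend to 0. So the target is a whole set of vertices on
-- which both laws are constant. The core is needed because a vertex may have several presentations.
-- Its stabiliser `H` need not preserve the image of the chosen injection `Fin d → Fin n`, but it
-- preserves whatever is defined from the vertex alone. The neighbours of `y` in one edge orbit may
-- form two `H`-orbits, when some permutation takes the neighbour `z` to `y`; they have equal size,
-- whence a factor 2 in the constants. Each step costs a factor `K * M`. Here `K` is the square of
-- the number of vertices at level `N`, and `M` is 2 times `d ^ d` (patterns on the core) times
-- `(d + 2) ^ (2d)` (`d + 2` options for each of the `2d` points to be avoided). A walk of `suc L`
-- steps thus costs `B = (K * M) ^ suc L`, which does not involve `n`; after `B * q` rounds of that
-- length the distance to `π` is at most `1/q`.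

bit : Bool → ℕ
bit b = if b then 1 else 0

does⇒ : ∀ {a} {A : Set a} (d : Dec A) → does d ≡ true → A
does⇒ (yes a) _ = a

∧-true : ∀ {a b} → a ∧ b ≡ true → a ≡ true × b ≡ true
∧-true {true} {true} _ = refl , refl

∧-intro : ∀ {a b} → a ≡ true → b ≡ true → a ∧ b ≡ true
∧-intro refl refl = refl

iff⇒≡ : ∀ {a b} → (a ≡ true → b ≡ true) → (b ≡ true → a ≡ true) → a ≡ b
iff⇒≡ {true}  f g = sym (f refl)
iff⇒≡ {false} {false} f g = refl
iff⇒≡ {false} {true}  f g = g refl

-- Counting in finite sets: union bounds and pigeonholes

count≡sum : ∀ k (p : Fin k → Bool) → count k p ≡ Σℕ.sum (bit ∘ p)
count≡sum zero    p = refl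
count≡sum (suc k) p = cong (bit (p zero) ℕ.+_) (count≡sum k (p ∘ suc))

bit-mono : ∀ {a b} → (a ≡ true → b ≡ true) → bit a ≤ bit b
bit-mono {true}  f rewrite f refl = ℕₚ.≤-refl
bit-mono {false} f = z≤n

count-mono : ∀ k {p q : Fin k → Bool} → (∀ x → p x ≡ true → q x ≡ true) → count k p ≤ count k q
count-mono zero    h = z≤n
count-mono (suc k) h = ℕₚ.+-mono-≤ (bit-mono (h zero)) (count-mono k (h ∘ suc))

count-cong : ∀ k {p q : Fin k → Bool} → (∀ x → p x ≡ q x) → count k p ≡ count k q
count-cong zero    h = refl
count-cong (suc k) h = cong₂ ℕ._+_ (cong bit (h zero)) (count-cong k (h ∘ suc))

count-⊎ : ∀ k {p q r : Fin k → Bool} → (∀ x → p x ≡ true → q x ≡ true ⊎ r x ≡ true) →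
          count k p ≤ count k q ℕ.+ count k r
count-⊎ zero    h = z≤n
count-⊎ (suc k) {p} {q} {r} h = begin
  bit (p zero) ℕ.+ count k (p ∘ suc)
    ≤⟨ ℕₚ.+-mono-≤ (head (p zero) (q zero) (r zero) (h zero)) (count-⊎ k (h ∘ suc)) ⟩
  (bit (q zero) ℕ.+ bit (r zero)) ℕ.+ (count k (q ∘ suc) ℕ.+ count k (r ∘ suc))
    ≡⟨ solve 4 (λ a b c d → (a :+ b) :+ (c :+ d) := (a :+ c) :+ (b :+ d)) refl (bit (q zero)) (bit (r zero)) _ _ ⟩
  (bit (q zero) ℕ.+ count k (q ∘ suc)) ℕ.+ (bit (r zero) ℕ.+ count k (r ∘ suc)) ∎
  where
  open ℕₚ.≤-Reasoning
  open ℕSolver.+-*-Solver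
  head : ∀ a b c → (a ≡ true → b ≡ true ⊎ c ≡ true) → bit a ≤ bit b ℕ.+ bit c
  head false _ _ _ = z≤n
  head true  b c f with f refl
  ... | inj₁ refl = s≤s z≤n
  ... | inj₂ refl = ℕₚ.m≤n+m 1 (bit b)

count-permute : ∀ k (p : Fin k → Bool) (π : Permutation′ k) → count k p ≡ count k (p ∘ (π ⟨$⟩ʳ_))
count-permute k p π =
  trans (count≡sum k p) (trans (Σℕ.sum-permute (bit ∘ p) π) (sym (count≡sum k _)))

count-pos : ∀ k (p : Fin k → Bool) x → p x ≡ true → 1 ≤ count k p
count-pos (suc k) p zero    h rewrite h = s≤s z≤n
count-pos (suc k) p (suc x) h = ℕₚ.≤-trans (count-pos k (p ∘ suc) x h) (ℕₚ.m≤n+m _ (bit (p zero)))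

count-none : ∀ k {p : Fin k → Bool} → (∀ x → p x ≢ true) → count k p ≡ 0
count-none zero    h = refl
count-none (suc k) {p} h with p zero in eq
... | true  = contradiction eq (h zero)
... | false = count-none k (h ∘ suc)

-- Union bound over `gs`: the points that one `g` sends into `q` are as many as the points of `q`,
-- because `g` is a bijection.
count-cover : ∀ k (gs : List (Permutation′ k)) (p q : Fin k → Bool) →
              (∀ x → p x ≡ true → ∃ λ g → g ∈ gs × q (g ⟨$⟩ʳ x) ≡ true) →
              count k p ≤ length gs ℕ.* count k q
count-cover k []       p q h = ℕₚ.≤-reflexive (count-none k λ x px → none (h x px))
  where
  none : ∀ {x} → ¬ (∃ λ g → g ∈ [] × q (g ⟨$⟩ʳ x) ≡ true)
  none (_ , () , _)
count-cover k (g ∷ gs) p q h = begin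
  count k p
    ≤⟨ count-⊎ k split ⟩
  count k (λ x → q (g ⟨$⟩ʳ x)) ℕ.+ count k p′
    ≤⟨ ℕₚ.+-mono-≤ (ℕₚ.≤-reflexive (sym (count-permute k q g))) (count-cover k gs p′ q rest) ⟩
  count k q ℕ.+ length gs ℕ.* count k q ∎
  where
  open ℕₚ.≤-Reasoning
  p′ : Fin k → Bool
  p′ x = p x ∧ not (q (g ⟨$⟩ʳ x))
  split : ∀ x → p x ≡ true → q (g ⟨$⟩ʳ x) ≡ true ⊎ p′ x ≡ true
  split x px with q (g ⟨$⟩ʳ x)
  ... | true  = inj₁ refl
  ... | false = inj₂ (∧-intro px refl)
  rest : ∀ x → p′ x ≡ true → ∃ λ g → g ∈ gs × q (g ⟨$⟩ʳ x) ≡ true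
  rest x e with ∧-true {p x} e
  ... | px , nq with h x px
  ...   | g′ , there m , qx = g′ , m , qx
  ...   | g′ , here refl , qx rewrite qx = contradiction nq λ ()

count-injective : ∀ k m (p : Fin k → Bool) (ix : Fin k → Fin m) →
                  (∀ x y → p x ≡ true → p y ≡ true → ix x ≡ ix y → x ≡ y) → count k p ≤ m
count-injective zero    m       p ix inj = z≤n
count-injective (suc k) zero    p ix inj with () ← ix zero
count-injective (suc k) (suc m) p ix inj with p zero in p0
... | false = count-injective k (suc m) (p ∘ suc) (ix ∘ suc) (λ x y px py e → suc-injective (inj _ _ px py e))
... | true  = s≤s (count-injective′ k m (p ∘ suc) (ix zero) (ix ∘ suc)
                 (λ x px e → 0≢1+n (inj _ _ p0 px e))
                 (λ x y px py e → suc-injective (inj _ _ px py e)))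
  where
  count-injective′ : ∀ k m (p : Fin k → Bool) (i₀ : Fin (suc m)) (ix : Fin k → Fin (suc m)) →
                     (∀ x → p x ≡ true → i₀ ≢ ix x) →
                     (∀ x y → p x ≡ true → p y ≡ true → ix x ≡ ix y → x ≡ y) → count k p ≤ m
  count-injective′ k zero p i₀ ix avoid inj = ℕₚ.≤-reflexive (count-none k λ x px → avoid x px (fin1 _ _))
    where
    fin1 : (a b : Fin 1) → a ≡ b
    fin1 zero zero = refl
  count-injective′ k (suc m) p i₀ ix avoid inj = count-injective k (suc m) p ix′ inj′
    where
    ix′ : Fin k → Fin (suc m)
    ix′ x with i₀ ≟ ix x
    -- A default: `avoid` excludes this case wherever `p` holds.
    ... | yes _  = zero
    ... | no  ne = punchOut ne
    inj′ : ∀ x y → p x ≡ true → p y ≡ true → ix′ x ≡ ix′ y → x ≡ y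
    inj′ x y px py e with i₀ ≟ ix x | i₀ ≟ ix y
    ... | yes e₁ | _      = contradiction e₁ (avoid x px)
    ... | no _   | yes e₂ = contradiction e₂ (avoid y py)
    ... | no n₁  | no n₂  = inj x y px py (punchOut-injective n₁ n₂ e)

least : ∀ k (p : Fin k → Bool) x → p x ≡ true →
        ∃ λ u → p u ≡ true × (∀ u′ → u′ Data.Fin.< u → p u′ ≢ true)
least (suc k) p x px with p zero in p0
... | true = zero , p0 , λ _ ()
least (suc k) p zero px | false = contradiction (trans (sym p0) px) λ ()
least (suc k) p (suc x) px | false with least k (p ∘ suc) x px
... | u , pu , m = suc u , pu , λ { zero _ e → contradiction (trans (sym p0) e) λ ()
                                  ; (suc u′) (s≤s lt) → m u′ lt }

-- Permutations of Fin n

Inj : ∀ {m n} → (Fin m → Fin n) → Set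
Inj f = Injective _≡_ _≡_ f

perm-injective : ∀ {n} (σ : Permutation′ n) → Inj (σ ⟨$⟩ʳ_)
perm-injective σ {x} {y} e = trans (sym (inverseˡ σ)) (trans (cong (σ ⟨$⟩ˡ_) e) (inverseˡ σ))

-- A missed value `y` could be punched out, which would inject `suc n` points into `n`.
inj⇒surj : ∀ {n} (f : Fin n → Fin n) → Inj f → ∀ y → ∃ λ x → f x ≡ y
inj⇒surj {suc n} f inj y with any? (λ x → f x ≟ y)
... | yes r = r
... | no ¬r = contradiction
  (injective⇒≤ {f = λ x → punchOut (ne x)} (λ {a} {b} e → inj (punchOut-injective (ne a) (ne b) e))) ℕₚ.1+n≰n
  where
  ne : ∀ x → y ≢ f x
  ne x e = ¬r (x , sym e)

inj⇒perm : ∀ {n} (f : Fin n → Fin n) → Inj f → Permutation′ n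
inj⇒perm f inj = permutation f (λ y → proj₁ (inj⇒surj f inj y))
  (λ y → proj₂ (inj⇒surj f inj y)) (λ x → inj (proj₂ (inj⇒surj f inj (f x))))

inj? : ∀ {m n} (f : Fin m → Fin n) → Dec (Inj f)
inj? f = map′ (λ h {x} {y} → h x y) (λ h x y → h)
              (all? λ x → all? λ y → (f x ≟ f y) →-dec (x ≟ y))

-- The search runs over the `n ^ n` codes of maps `Fin n → Fin n`. Coding and decoding recovers a
-- permutation only up to pointwise equality, so the property has to respect `≈`.
anyPerm? : ∀ {n} {P : Permutation′ n → Set} →
           (∀ {σ τ} → σ Perm.≈ τ → P σ → P τ) → (∀ σ → Dec (P σ)) → Dec (∃ P)
anyPerm? {n} {P} resp P? =
  map′ (λ { (i , inj , p) → inj⇒perm (finToFun i) inj , p }) to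
       (any? {n ℕ.^ n} λ i → Q? i)
  where
  Q : Fin (n ℕ.^ n) → Set
  Q i = Σ (Inj (finToFun {n} {n} i)) λ inj → P (inj⇒perm (finToFun i) inj)
  Q? : ∀ i → Dec (Q i)
  Q? i with inj? (finToFun {n} {n} i)
  ... | no ¬inj = no λ q → ¬inj (proj₁ q)
  ... | yes inj = map′ (inj ,_) (λ { (_ , p) → resp (λ _ → refl) p }) (P? (inj⇒perm (finToFun i) inj))
  to : ∃ P → ∃ Q
  to (σ , p) = i , inj , resp (λ x → sym (eq x)) p
    where
    i  = funToFin (σ ⟨$⟩ʳ_)
    eq = finToFun-funToFin {n} {n} (σ ⟨$⟩ʳ_)
    inj : Inj (finToFun {n} {n} i)
    inj {x} {y} e = perm-injective σ (trans (sym (eq x)) (trans e (eq y)))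

transpose-≡ˡ : ∀ {n} (i j : Fin n) → PC.transpose i j i ≡ j
transpose-≡ˡ i j rewrite dec-true (i ≟ i) refl = refl

transpose-≡ʳ : ∀ {n} (i j : Fin n) → PC.transpose i j j ≡ i
transpose-≡ʳ i j with j ≟ i
... | yes e = e
... | no _ rewrite dec-true (j ≟ j) refl = refl

transpose-≢ : ∀ {n} (i j : Fin n) {k} → k ≢ i → k ≢ j → PC.transpose i j k ≡ k
transpose-≢ i j {k} ki kj rewrite dec-false (k ≟ i) ki | dec-false (k ≟ j) kj = refl

fresh : ∀ {n} (ys : List (Fin n)) → length ys < n → ∃ λ x → x ∉ ys
fresh {n} ys lt with any? (λ x → ¬? (_∈?_ _≟_ x ys))
... | yes r = r
... | no ¬r = contradiction (injective⇒≤ {f = λ x → index (mem x)} inj) (ℕₚ.<⇒≱ lt)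
  where
  mem : ∀ x → x ∈ ys
  mem x = decidable-stable (_∈?_ _≟_ x ys) (λ ne → ¬r (x , ne))
  inj : Inj (λ x → index (mem x))
  inj {x} {y} e = trans (lookup-index (mem x)) (trans (cong (List.lookup ys) e) (sym (lookup-index (mem y))))

freshInjection : ∀ {n} m (ys : List (Fin n)) → m ℕ.+ length ys ≤ n →
                 ∃ λ (f : Fin m → Fin n) → Inj f × (∀ i → f i ∉ ys)
freshInjection zero    ys le = (λ ()) , (λ { {()} }) , λ ()
freshInjection {n} (suc m) ys le with fresh ys (ℕₚ.≤-trans (s≤s (ℕₚ.m≤n+m _ m)) le)
... | x , x∉ with freshInjection m (x ∷ ys) (subst (_≤ n) (sym (ℕₚ.+-suc m (length ys))) le)
...   | f , inj , av = g , ginj , gav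
  where
  g : Fin (suc m) → Fin n
  g zero    = x
  g (suc i) = f i
  ginj : Inj g
  ginj {zero}  {zero}  e = refl
  ginj {zero}  {suc j} e = contradiction (here (sym e)) (av j)
  ginj {suc i} {zero}  e = contradiction (here e) (av i)
  ginj {suc i} {suc j} e = cong suc (inj e)
  gav : ∀ i → g i ∉ ys
  gav zero    = x∉
  gav (suc i) = av i ∘ there

-- Values are corrected one at a time by transpositions. That points off both images stay fixed is
-- what later makes `σ` fix two given vertices while it moves a third.
extend : ∀ {n} m (f f′ : Fin m → Fin n) → Inj f → Inj f′ →
         ∃ λ (σ : Permutation′ n) → (∀ i → σ ⟨$⟩ʳ f i ≡ f′ i) ×
           (∀ x → (∀ i → f i ≢ x) → (∀ i → f′ i ≢ x) → σ ⟨$⟩ʳ x ≡ x)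
extend zero f f′ inj inj′ = Perm.id , (λ ()) , λ _ _ _ → refl
extend {n} (suc m) f f′ inj inj′
  with extend m (f ∘ suc) (f′ ∘ suc) (suc-injective ∘ inj) (suc-injective ∘ inj′)
... | σ , ext , fix = σ ∘ₚ transpose a b , ext′ , fix′
  where
  a = σ ⟨$⟩ʳ f zero
  b = f′ zero
  ext′ : ∀ i → PC.transpose a b (σ ⟨$⟩ʳ f i) ≡ f′ i
  ext′ zero    = transpose-≡ˡ a b
  ext′ (suc i) = trans (cong (PC.transpose a b) (ext i)) (transpose-≢ a b
    (λ e → 0≢1+n (inj (perm-injective σ (sym (trans (ext i) e)))))
    (λ e → 0≢1+n (inj′ (sym e))))
  fix′ : ∀ x → (∀ i → f i ≢ x) → (∀ i → f′ i ≢ x) → PC.transpose a b (σ ⟨$⟩ʳ x) ≡ x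
  fix′ x nf nf′ = trans (cong (PC.transpose a b) σx) (transpose-≢ a b
    (λ e → nf zero (perm-injective σ (sym (trans σx e)))) (λ e → nf′ zero (sym e)))
    where σx = fix x (nf ∘ suc) (nf′ ∘ suc)

length-cartesianProductWith : ∀ {a b c} {A : Set a} {B : Set b} {C : Set c} (f : A → B → C) xs ys →
                              length (cartesianProductWith f xs ys) ≡ length xs ℕ.* length ys
length-cartesianProductWith f []       ys = refl
length-cartesianProductWith f (x ∷ xs) ys = trans (List.length-++ (List.map (f x) ys))
  (cong₂ ℕ._+_ (List.length-map (f x) ys) (length-cartesianProductWith f xs ys))

-- The symmetric group acting on vertices, and its orbits on edges and on ordered pairs

module Action (Γ : FIGraph) (n : ℕ) where

  Vx : Set
  Vx = Fin (V (G Γ n))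

  act : Permutation′ n → Vx → Vx
  act σ = map Γ (σ ⟨$⟩ʳ_) (perm-injective σ)

  act-map : ∀ {m} (σ : Permutation′ n) {f f′ : Fin m → Fin n} (inj : Inj f) (inj′ : Inj f′) →
            (∀ i → σ ⟨$⟩ʳ f i ≡ f′ i) → ∀ u → act σ (map Γ f inj u) ≡ map Γ f′ inj′ u
  act-map σ {f} {f′} inj inj′ eq u = trans
    (sym (map-∘ Γ f (σ ⟨$⟩ʳ_) inj (perm-injective σ) (inj ∘ perm-injective σ) u))
    (map-cong Γ _ f′ (inj ∘ perm-injective σ) inj′ eq u)

  act-cong : ∀ {σ τ} → σ Perm.≈ τ → ∀ v → act σ v ≡ act τ v
  act-cong {σ} {τ} = map-cong Γ _ _ (perm-injective σ) (perm-injective τ)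

  act-id : ∀ {σ} → (∀ x → σ ⟨$⟩ʳ x ≡ x) → ∀ v → act σ v ≡ v
  act-id {σ} eq v = trans (map-cong Γ _ id (perm-injective σ) id eq v) (map-id Γ id v)

  act-∘ : ∀ σ τ v → act (σ ∘ₚ τ) v ≡ act τ (act σ v)
  act-∘ σ τ v = map-∘ Γ _ _ (perm-injective σ) (perm-injective τ) (perm-injective (σ ∘ₚ τ)) v

  act-flipˡ : ∀ σ v → act (flip σ) (act σ v) ≡ v
  act-flipˡ σ v = trans (sym (act-∘ σ (flip σ) v)) (act-id {σ ∘ₚ flip σ} (λ _ → inverseˡ σ) v)

  act-flipʳ : ∀ σ v → act σ (act (flip σ) v) ≡ v
  act-flipʳ σ v = trans (sym (act-∘ (flip σ) σ v)) (act-id {flip σ ∘ₚ σ} (λ _ → inverseʳ σ) v)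

  act-flip : ∀ σ {v w} → act σ v ≡ w → act (flip σ) w ≡ v
  act-flip σ {v} refl = act-flipˡ σ v

  actₚ : Permutation′ n → Permutation′ (V (G Γ n))
  actₚ σ = permutation (act σ) (act (flip σ)) (act-flipʳ σ) (act-flipˡ σ)

  adj-act : ∀ σ v w → adj (G Γ n) (act σ v) (act σ w) ≡ adj (G Γ n) v w
  adj-act σ v w = iff⇒≡
    (λ e → trans (sym (cong₂ (adj (G Γ n)) (act-flipˡ σ v) (act-flipˡ σ w)))
                 (map-hom Γ _ (perm-injective (flip σ)) _ _ e))
    (map-hom Γ _ (perm-injective σ) v w)

  Orbit : (a b c d : Vx) → Set
  Orbit a b c d = ∃ λ σ → (act σ a ≡ c × act σ b ≡ d) ⊎ (act σ a ≡ d × act σ b ≡ c)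

  sameOrbit⇒orbit : ∀ {a b c d} → SameOrbit Γ n a b c d → Orbit a b c d
  sameOrbit⇒orbit (σ , inj , m) = inj⇒perm (lookup σ) inj , m

  orbit⇒sameOrbit : ∀ {a b c d} → Orbit a b c d → SameOrbit Γ n a b c d
  orbit⇒sameOrbit {a} {b} (σ , m) = σv , inj , maps m
    where
    σv = tabulate (σ ⟨$⟩ʳ_)
    eq = lookup∘tabulate (σ ⟨$⟩ʳ_)
    inj : Inj (lookup σv)
    inj {x} {y} e = perm-injective σ (trans (sym (eq x)) (trans e (eq y)))
    to : ∀ {v w} → act σ v ≡ w → map Γ (lookup σv) inj v ≡ w
    to {v} e = trans (map-cong Γ _ _ inj (perm-injective σ) eq v) e
    maps : ∀ {c d} → (act σ a ≡ c × act σ b ≡ d) ⊎ (act σ a ≡ d × act σ b ≡ c) → MapsEdge Γ (lookup σv) inj a b c d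
    maps (inj₁ (p , q)) = inj₁ (to p , to q)
    maps (inj₂ (p , q)) = inj₂ (to p , to q)

  orbit-refl : ∀ {a b} → Orbit a b a b
  orbit-refl {a} {b} = Perm.id , inj₁ (act-id {Perm.id} (λ _ → refl) a , act-id {Perm.id} (λ _ → refl) b)

  orbit-sym : ∀ {a b c d} → Orbit a b c d → Orbit c d a b
  orbit-sym (σ , inj₁ (p , q)) = flip σ , inj₁ (act-flip σ p , act-flip σ q)
  orbit-sym (σ , inj₂ (p , q)) = flip σ , inj₂ (act-flip σ q , act-flip σ p)

  act-trans : ∀ σ τ {u v w} → act σ u ≡ v → act τ v ≡ w → act (σ ∘ₚ τ) u ≡ w
  act-trans σ τ {u} refl refl = act-∘ σ τ u

  orbit-trans : ∀ {a b c d e f} → Orbit a b c d → Orbit c d e f → Orbit a b e f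
  orbit-trans (σ , inj₁ (p , q)) (τ , inj₁ (r , s)) = σ ∘ₚ τ , inj₁ (act-trans σ τ p r , act-trans σ τ q s)
  orbit-trans (σ , inj₁ (p , q)) (τ , inj₂ (r , s)) = σ ∘ₚ τ , inj₂ (act-trans σ τ p r , act-trans σ τ q s)
  orbit-trans (σ , inj₂ (p , q)) (τ , inj₁ (r , s)) = σ ∘ₚ τ , inj₂ (act-trans σ τ p s , act-trans σ τ q r)
  orbit-trans (σ , inj₂ (p , q)) (τ , inj₂ (r , s)) = σ ∘ₚ τ , inj₁ (act-trans σ τ p s , act-trans σ τ q r)

  orbit-act : ∀ σ {a b} → Orbit a b (act σ a) (act σ b)
  orbit-act σ = σ , inj₁ (refl , refl)

  abstract
    orbᵇ : (a b c d : Vx) → Bool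
    orbᵇ a b c d = does (sameOrbit? Γ n a b c d)

    orbᵇ⇒ : ∀ {a b c d} → orbᵇ a b c d ≡ true → Orbit a b c d
    orbᵇ⇒ {a} {b} {c} {d} e = sameOrbit⇒orbit (does⇒ (sameOrbit? Γ n a b c d) e)

    ⇒orbᵇ : ∀ {a b c d} → Orbit a b c d → orbᵇ a b c d ≡ true
    ⇒orbᵇ {a} {b} {c} {d} o = dec-true (sameOrbit? Γ n a b c d) (orbit⇒sameOrbit o)

    orbitDegree≡ : ∀ y z → orbitDegree Γ n y z ≡ count (V (G Γ n)) (λ u → adj (G Γ n) y u ∧ orbᵇ y u y z)
    orbitDegree≡ y z = refl

  -- With `a` equal to `y` this cuts out the orbit of `z` under the stabiliser of `y`. Edge orbits
  -- are coarser, since they also admit reversal.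
  PairOrbit : (y z a b : Vx) → Set
  PairOrbit y z a b = ∃ λ σ → act σ y ≡ a × act σ z ≡ b

  abstract
    pairOrbit? : ∀ y z a b → Dec (PairOrbit y z a b)
    pairOrbit? y z a b = anyPerm?
      (λ {σ} {τ} eq (p , q) → trans (sym (act-cong {σ} {τ} eq y)) p , trans (sym (act-cong {σ} {τ} eq z)) q)
      (λ σ → (act σ y ≟ a) ×-dec (act σ z ≟ b))

  pairᵇ : (y z a b : Vx) → Bool
  pairᵇ y z a b = does (pairOrbit? y z a b)

  pairᵇ⇒ : ∀ {y z a b} → pairᵇ y z a b ≡ true → PairOrbit y z a b
  pairᵇ⇒ {y} {z} {a} {b} = does⇒ (pairOrbit? y z a b)

  ⇒pairᵇ : ∀ {y z a b} → PairOrbit y z a b → pairᵇ y z a b ≡ true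
  ⇒pairᵇ {y} {z} {a} {b} = dec-true (pairOrbit? y z a b)

  pairᵇ-act : ∀ {y z} σ a b → pairᵇ y z (act σ a) (act σ b) ≡ pairᵇ y z a b
  pairᵇ-act {y} {z} σ a b = iff⇒≡
    (λ e → let τ , p , q = pairᵇ⇒ e in ⇒pairᵇ (τ ∘ₚ flip σ ,
       trans (act-trans τ (flip σ) p refl) (act-flipˡ σ a) , trans (act-trans τ (flip σ) q refl) (act-flipˡ σ b)))
    (λ e → let τ , p , q = pairᵇ⇒ e in ⇒pairᵇ (τ ∘ₚ σ , act-trans τ σ p refl , act-trans τ σ q refl))

  private
    k = V (G Γ n)

  sum-rows : ∀ k (p : Fin k → Bool) (c : Fin k → ℕ) r →
             (∀ x → p x ≡ true → c x ≡ r) → (∀ x → p x ≡ false → c x ≡ 0) →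
             Σℕ.sum c ≡ count k p ℕ.* r
  sum-rows zero    p c r h₁ h₀ = refl
  sum-rows (suc k) p c r h₁ h₀ with p zero in eq
  ... | true  = cong₂ ℕ._+_ (h₁ zero eq) (sum-rows k (p ∘ suc) (c ∘ suc) r (h₁ ∘ suc) (h₀ ∘ suc))
  ... | false = cong₂ ℕ._+_ (h₀ zero eq) (sum-rows k (p ∘ suc) (c ∘ suc) r (h₁ ∘ suc) (h₀ ∘ suc))

  -- Double counting of the orbit of (y , z).
  row≡column : ∀ y z {w} → PairOrbit y z w y → count k (pairᵇ y z y) ≡ count k (λ a → pairᵇ y z a y)
  row≡column y z {w} (ρ , ρy , ρz) =
    ℕₚ.*-cancelˡ-≡ _ _ (count k A) {{ℕ.>-nonZero (count-pos k A y Ay)}} (begin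
      count k A ℕ.* count k (pairᵇ y z y)
        ≡⟨ sum-rows k A (λ a → count k (pairᵇ y z a)) _ row₁ row₀ ⟨
      Σℕ.sum (λ a → count k (pairᵇ y z a))
        ≡⟨ Σℕ.sum-cong-≗ (λ a → count≡sum k (pairᵇ y z a)) ⟩
      Σℕ.sum (λ a → Σℕ.sum (λ b → bit (pairᵇ y z a b)))
        ≡⟨ Σℕ.∑-comm {k} {k} (λ a b → bit (pairᵇ y z a b)) ⟩
      Σℕ.sum (λ b → Σℕ.sum (λ a → bit (pairᵇ y z a b)))
        ≡⟨ Σℕ.sum-cong-≗ (λ b → count≡sum k (λ a → pairᵇ y z a b)) ⟨
      Σℕ.sum (λ b → count k (λ a → pairᵇ y z a b))
        ≡⟨ sum-rows k A (λ b → count k (λ a → pairᵇ y z a b)) _ col₁ col₀ ⟩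
      count k A ℕ.* count k (λ a → pairᵇ y z a y) ∎)
    where
    open ≡-Reasoning
    -- `A` marks the vertex orbit of `y`. Its rows all have one size and its columns another;
    -- outside it both are empty, the columns because `ρ` puts `z` into the orbit of `y`.
    A : Vx → Bool
    A a = pairᵇ y y a a
    Ay : A y ≡ true
    Ay = ⇒pairᵇ (Perm.id , act-id {Perm.id} (λ _ → refl) y , act-id {Perm.id} (λ _ → refl) y)
    row₁ : ∀ a → A a ≡ true → count k (pairᵇ y z a) ≡ count k (pairᵇ y z y)
    row₁ a e with pairᵇ⇒ e
    ... | σ , refl , _ = trans (count-permute k _ (actₚ σ)) (count-cong k λ b → pairᵇ-act σ y b)
    row₀ : ∀ a → A a ≡ false → count k (pairᵇ y z a) ≡ 0
    row₀ a e = count-none k λ b t → let σ , p , _ = pairᵇ⇒ t in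
      contradiction (trans (sym e) (⇒pairᵇ (σ , p , p))) λ ()
    col₁ : ∀ b → A b ≡ true → count k (λ a → pairᵇ y z a b) ≡ count k (λ a → pairᵇ y z a y)
    col₁ b e with pairᵇ⇒ e
    ... | σ , refl , _ = trans (count-permute k _ (actₚ σ)) (count-cong k λ a → pairᵇ-act σ a y)
    col₀ : ∀ b → A b ≡ false → count k (λ a → pairᵇ y z a b) ≡ 0
    col₀ b e = count-none k λ a t → let σ , p , q = pairᵇ⇒ t
                                        r = trans (act-trans (flip ρ) σ (act-flip ρ ρz) q) refl in
      contradiction (trans (sym e) (⇒pairᵇ (flip ρ ∘ₚ σ , r , r))) λ ()

  -- The edges at y in one edge orbit form a stabiliser orbit of neighbours and, if the edge can be
  -- reversed, a second one of the same size.
  orbitDegree≤ : ∀ y z → orbitDegree Γ n y z ≤ 2 ℕ.* count k (pairᵇ y z y)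
  orbitDegree≤ y z = begin
    orbitDegree Γ n y z                                        ≡⟨ orbitDegree≡ y z ⟩
    count k (λ u → adj (G Γ n) y u ∧ orbᵇ y u y z)             ≤⟨ count-⊎ k split ⟩
    count k (pairᵇ y z y) ℕ.+ count k (λ a → pairᵇ y z a y)    ≤⟨ ℕₚ.+-monoʳ-≤ (count k (pairᵇ y z y)) col≤row ⟩
    count k (pairᵇ y z y) ℕ.+ count k (pairᵇ y z y)            ≡⟨ cong (count k (pairᵇ y z y) ℕ.+_) (ℕₚ.+-identityʳ _) ⟨
    2 ℕ.* count k (pairᵇ y z y)                                ∎
    where
    open ℕₚ.≤-Reasoning
    split : ∀ u → (adj (G Γ n) y u ∧ orbᵇ y u y z) ≡ true → pairᵇ y z y u ≡ true ⊎ pairᵇ y z u y ≡ true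
    split u e with orbᵇ⇒ (proj₂ (∧-true {adj (G Γ n) y u} e))
    ... | σ , inj₁ (p , q) = inj₁ (⇒pairᵇ (flip σ , act-flip σ p , act-flip σ q))
    ... | σ , inj₂ (p , q) = inj₂ (⇒pairᵇ (flip σ , act-flip σ q , act-flip σ p))
    col≤row : count k (λ a → pairᵇ y z a y) ≤ count k (pairᵇ y z y)
    -- Either some translate of the pair ends in `y`, and the double counting applies, or the column
    -- is empty.
    col≤row with any? (λ w → pairOrbit? y z w y)
    ... | yes (w , p) = ℕₚ.≤-reflexive (sym (row≡column y z p))
    ... | no ¬p = subst (_≤ count k (pairᵇ y z y)) (sym (count-none k λ a t → ¬p (a , pairᵇ⇒ t))) z≤n

  -- The core of a vertex and the action of its stabiliser

  module Core (y : Vx) (d : ℕ) (e : Fin d → Fin n)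
              (supp : ∀ σ → (∀ i → σ ⟨$⟩ʳ e i ≡ e i) → act σ y ≡ y)
              (2d<n : d ℕ.+ d < n) where

    Fixes : Permutation′ n → Set
    Fixes σ = act σ y ≡ y

    -- Depends on `y` alone and not on the injection `e`, so every permutation that fixes `y`
    -- preserves it.
    _∼_ : Fin n → Fin n → Set
    p ∼ q = Fixes (transpose p q)

    fixes-flip : ∀ {σ} → Fixes σ → Fixes (flip σ)
    fixes-flip {σ} = act-flip σ

    ∼-refl : ∀ p → p ∼ p
    ∼-refl p = act-id {transpose p p} eq y
      where
      eq : ∀ x → PC.transpose p p x ≡ x
      eq x with x ≟ p
      ... | yes refl = refl
      ... | no x≢p with x ≟ p
      ...   | yes x≡p = contradiction x≡p x≢p
      ...   | no _    = refl

    ∼-sym : ∀ {p q} → p ∼ q → q ∼ p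
    ∼-sym {p} {q} = act-flip (transpose p q)

    ∼-conj : ∀ {σ p q} → Fixes σ → p ∼ q → (σ ⟨$⟩ʳ p) ∼ (σ ⟨$⟩ʳ q)
    ∼-conj {σ} {p} {q} fσ pq = trans (act-cong {transpose (σ ⟨$⟩ʳ p) (σ ⟨$⟩ʳ q)} {ρ} eq y)
      (act-trans (flip σ) (transpose p q ∘ₚ σ) (fixes-flip {σ} fσ) (act-trans (transpose p q) σ pq fσ))
      where
      ρ = flip σ ∘ₚ transpose p q ∘ₚ σ
      eq : ∀ x → PC.transpose (σ ⟨$⟩ʳ p) (σ ⟨$⟩ʳ q) x ≡ σ ⟨$⟩ʳ PC.transpose p q (σ ⟨$⟩ˡ x)
      eq x = go (x ≟ σ ⟨$⟩ʳ p) (x ≟ σ ⟨$⟩ʳ q)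
        where
        pull : ∀ {x z w} → σ ⟨$⟩ˡ x ≡ z → PC.transpose p q z ≡ w → σ ⟨$⟩ʳ w ≡ σ ⟨$⟩ʳ PC.transpose p q (σ ⟨$⟩ˡ x)
        pull refl refl = refl
        push : ∀ {z} → σ ⟨$⟩ˡ x ≡ z → x ≡ σ ⟨$⟩ʳ z
        push eq = trans (sym (inverseʳ σ)) (cong (σ ⟨$⟩ʳ_) eq)
        go : Dec (x ≡ σ ⟨$⟩ʳ p) → Dec (x ≡ σ ⟨$⟩ʳ q) →
             PC.transpose (σ ⟨$⟩ʳ p) (σ ⟨$⟩ʳ q) x ≡ σ ⟨$⟩ʳ PC.transpose p q (σ ⟨$⟩ˡ x)
        go (yes refl) _          = trans (transpose-≡ˡ (σ ⟨$⟩ʳ p) (σ ⟨$⟩ʳ q)) (pull (inverseˡ σ) (transpose-≡ˡ p q))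
        go (no _)     (yes refl) = trans (transpose-≡ʳ (σ ⟨$⟩ʳ p) (σ ⟨$⟩ʳ q)) (pull (inverseˡ σ) (transpose-≡ʳ p q))
        go (no ≢p)    (no ≢q)    = trans (transpose-≢ (σ ⟨$⟩ʳ p) (σ ⟨$⟩ʳ q) ≢p ≢q) (trans (sym (inverseʳ σ))
          (pull refl (transpose-≢ p q (≢p ∘ push) (≢q ∘ push))))

    ∼-trans : ∀ {p q s} → p ∼ q → q ∼ s → p ∼ s
    ∼-trans {p} {q} {s} pq qs with p ≟ q | p ≟ s
    ... | yes refl | _        = qs
    ... | no _     | yes refl = ∼-refl p
    -- Conjugating the swap of `p` and `q` by the swap of `q` and `s` gives the swap of `p` and `s`,
    -- as `p` is neither `q` nor `s`.
    ... | no p≢q   | no p≢s   = trans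
      (cong₂ (λ a b → act (transpose a b) y) (sym (transpose-≢ q s p≢q p≢s)) (sym (transpose-≡ˡ q s)))
      (∼-conj {transpose q s} qs pq)

    private
      r-fresh : ∃ λ r → r ∉ List.tabulate e
      r-fresh = fresh (List.tabulate e)
        (subst (_< n) (sym (List.length-tabulate e)) (ℕₚ.≤-<-trans (ℕₚ.m≤m+n d d) 2d<n))

    r : Fin n
    r = proj₁ r-fresh

    outside∼ : ∀ {p q} → (∀ i → e i ≢ p) → (∀ i → e i ≢ q) → p ∼ q
    outside∼ {p} {q} np nq = supp (transpose p q) λ i → transpose-≢ p q (np i) (nq i)

    r∉e : ∀ i → e i ≢ r
    r∉e i eq = proj₂ r-fresh (subst (_∈ List.tabulate e) eq (∈-tabulate⁺ i))

    -- The points off the image of e are all ∼-equivalent, so the core lies in that image; unlike the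
    -- image of e it is determined by y.
    Core : Fin n → Set
    Core p = ¬ (p ∼ r)

    core? : ∀ p → Dec (Core p)
    core? p = ¬? (act (transpose p r) y ≟ y)

    -- Since `2d < n`, some `q` lies off the image of `e` and off its preimage under `σ`. Then
    -- `r ∼ q` gives `σ r ∼ σ q`, and `σ q` is off the image of `e`, hence equivalent to `r`. So the
    -- stabiliser preserves the class of `r`, and with it the core.
    fixes-r : ∀ {σ} → Fixes σ → (σ ⟨$⟩ʳ r) ∼ r
    fixes-r {σ} fσ = ∼-trans (∼-conj {σ} fσ (outside∼ r∉e q∉e)) (outside∼ σq∉e r∉e)
      where
      ys = List.tabulate e ++ List.tabulate (λ i → σ ⟨$⟩ˡ e i)
      q-fresh : ∃ λ q → q ∉ ys
      q-fresh = fresh ys (subst (_< n) (sym (trans (List.length-++ (List.tabulate e))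
                  (cong₂ ℕ._+_ (List.length-tabulate e) (List.length-tabulate (λ i → σ ⟨$⟩ˡ e i))))) 2d<n)
      q = proj₁ q-fresh
      q∉e : ∀ i → e i ≢ q
      q∉e i eq = proj₂ q-fresh (∈-++⁺ˡ (subst (_∈ List.tabulate e) eq (∈-tabulate⁺ i)))
      σq∉e : ∀ i → e i ≢ σ ⟨$⟩ʳ q
      σq∉e i eq = proj₂ q-fresh (∈-++⁺ʳ (List.tabulate e)
        (subst (_∈ List.tabulate (λ i → σ ⟨$⟩ˡ e i)) (trans (cong (σ ⟨$⟩ˡ_) eq) (inverseˡ σ)) (∈-tabulate⁺ i)))

    core-stable : ∀ {σ p} → Fixes σ → Core p → Core (σ ⟨$⟩ʳ p)
    core-stable {σ} {p} fσ cp σp∼r = cp (subst (_∼ r) (inverseˡ σ)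
      (∼-trans (∼-conj {flip σ} (fixes-flip {σ} fσ) σp∼r) (fixes-r {flip σ} (fixes-flip {σ} fσ))))

    core⊆e : ∀ {p} → Core p → ∃ λ i → e i ≡ p
    core⊆e {p} cp with any? (λ i → e i ≟ p)
    ... | yes i = i
    ... | no ¬i = contradiction (outside∼ (λ i eq → ¬i (i , eq)) r∉e) cp

    noncore-swap : ∀ {p q} → ¬ Core p → ¬ Core q → Fixes (transpose p q)
    noncore-swap {p} {q} np nq = ∼-trans (stable p np) (∼-sym (stable q nq))
      where
      stable : ∀ p → ¬ Core p → p ∼ r
      stable p = decidable-stable (act (transpose p r) y ≟ y)

    private
      -- `α` codes a map of indices `Fin d → Fin d`, read only at indices of core points; there are
      -- `d ^ d` codes, the source of that constant.
      Follows : Fin (d ℕ.^ d) → Permutation′ n → Set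
      Follows α σ = Fixes σ × (∀ i → Core (e i) → σ ⟨$⟩ʳ e i ≡ e (finToFun α i))

      abstract
        follows? : ∀ α → Dec (∃ (Follows α))
        follows? α = anyPerm?
          (λ {σ} {τ} eq (fσ , m) → trans (sym (act-cong {σ} {τ} eq y)) fσ , λ i c → trans (sym (eq (e i))) (m i c))
          (λ σ → (act σ y ≟ y) ×-dec all? λ i → core? (e i) →-dec (σ ⟨$⟩ʳ e i ≟ e (finToFun α i)))

      pick : Fin (d ℕ.^ d) → Permutation′ n
      pick α with follows? α
      ... | yes (σ , _) = σ
      ... | no _        = Perm.id

      pick-follows : ∀ α {σ} → Follows α σ → Follows α (pick α)
      pick-follows α {σ} f with follows? α
      ... | yes (_ , g) = g
      ... | no ¬g       = contradiction (σ , f) ¬g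

    -- One element of the stabiliser for each permutation that it induces on the core (padded by the
    -- identity).
    patterns : List (Permutation′ n)
    patterns = List.tabulate pick

    patterns-cover : ∀ {σ} → Fixes σ → ∃ λ h → h ∈ patterns × Fixes h × (∀ p → Core p → h ⟨$⟩ʳ p ≡ σ ⟨$⟩ʳ p)
    patterns-cover {σ} fσ = pick α , ∈-tabulate⁺ α , proj₁ pf , agree
      where
      target : ∀ i → ∃ λ j → Core (e i) → σ ⟨$⟩ʳ e i ≡ e j
      target i with core? (e i)
      -- Off the core the index is a default that `Follows` never reads; on the core the image is
      -- again a core point and so has an index.
      ... | no ¬c = i , λ c → contradiction c ¬c
      ... | yes c with core⊆e (core-stable {σ} fσ c)
      ...   | j , eq = j , λ _ → sym eq
      α = funToFin (proj₁ ∘ target)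
      σα : ∀ i → Core (e i) → σ ⟨$⟩ʳ e i ≡ e (finToFun α i)
      σα i c = trans (proj₂ (target i) c) (cong e (sym (finToFun-funToFin (proj₁ ∘ target) i)))
      pf = pick-follows α {σ} (fσ , σα)
      agree : ∀ p → Core p → pick α ⟨$⟩ʳ p ≡ σ ⟨$⟩ʳ p
      agree p c with core⊆e c
      ... | i , refl = trans (proj₂ pf i c) (sym (σα i c))

    module _ (bs : Fin (suc d) → Fin n) (bs-inj : Inj bs) (bs∉e : ∀ j i → e i ≢ bs j) where

      -- Points of xs are moved, one after the other, to one of the d + 1 points bs, which d points
      -- cannot all occupy.
      moves : List (Fin n) → List (Permutation′ n)
      moves []       = Perm.id ∷ []
      moves (x ∷ xs) = moves xs ++ cartesianProductWith (λ j k → k ∘ₚ transpose x (bs j)) (List.tabulate id) (moves xs)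

      -- Each point of `xs` has `d + 2` options: no move, or a swap with one of the `d + 1` points
      -- `bs`.
      length-moves : ∀ xs → length (moves xs) ≡ (2 ℕ.+ d) ℕ.^ length xs
      length-moves []       = refl
      length-moves (x ∷ xs) = begin
        length (moves xs ++ cartesianProductWith _ (List.tabulate {n = suc d} id) (moves xs))
          ≡⟨ List.length-++ (moves xs) ⟩
        length (moves xs) ℕ.+ length (cartesianProductWith _ (List.tabulate {n = suc d} id) (moves xs))
          ≡⟨ cong (length (moves xs) ℕ.+_) (trans (length-cartesianProductWith _ (List.tabulate {n = suc d} id) (moves xs))
               (cong (ℕ._* length (moves xs)) (List.length-tabulate {n = suc d} id))) ⟩
        (2 ℕ.+ d) ℕ.* length (moves xs)
          ≡⟨ cong ((2 ℕ.+ d) ℕ.*_) (length-moves xs) ⟩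
        (2 ℕ.+ d) ℕ.^ length (x ∷ xs) ∎
        where open ≡-Reasoning

      -- Only points off the core are swapped, which keeps `y` fixed; the core values of `g` stay in
      -- place and must therefore avoid `xs` from the start. An offending value goes to an
      -- unoccupied `bs j`, so points of `xs` already cleared remain clear.
      moves-avoid : ∀ xs → (∀ j → bs j ∉ xs) → (g : Fin d → Fin n) → (∀ i → Core (g i) → g i ∉ xs) →
                    ∃ λ k → k ∈ moves xs × Fixes k × (∀ p → Core p → k ⟨$⟩ʳ p ≡ p) × (∀ i → k ⟨$⟩ʳ g i ∉ xs)
      moves-avoid [] _ g _ = Perm.id , here refl , act-id {Perm.id} (λ _ → refl) y , (λ _ _ → refl) , λ _ ()
      moves-avoid (x ∷ xs) bs∉ g g∉ with moves-avoid xs (λ j → bs∉ j ∘ there) g (λ i c → g∉ i c ∘ there)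
      ... | k , k∈ , fk , kc , kg with any? (λ i → k ⟨$⟩ʳ g i ≟ x)
      ...   | no ¬hit = k , ∈-++⁺ˡ k∈ , fk , kc , λ { i (here eq) → ¬hit (i , eq) ; i (there m) → kg i m }
      ...   | yes (i₀ , hit) with any? (λ j → all? λ i → ¬? (k ⟨$⟩ʳ g i ≟ bs j))
      ...     | no ¬free = contradiction
                  (injective⇒≤ {f = λ j → proj₁ (taken j)}
                     (λ {j} {j′} eq → bs-inj (trans (sym (proj₂ (taken j)))
                        (trans (cong (λ i → k ⟨$⟩ʳ g i) eq) (proj₂ (taken j′)))))) ℕₚ.1+n≰n
        where
        taken : ∀ j → ∃ λ i → k ⟨$⟩ʳ g i ≡ bs j
        taken j = decidable-stable (any? λ i → k ⟨$⟩ʳ g i ≟ bs j) (λ ¬t → ¬free (j , λ i eq → ¬t (i , eq)))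
      ...     | yes (j , free) = k ∘ₚ transpose x b
                , ∈-++⁺ʳ (moves xs) (∈-cartesianProductWith⁺ (λ j k → k ∘ₚ transpose x (bs j)) (∈-tabulate⁺ {f = id} j) k∈)
                , act-trans k (transpose x b) fk (noncore-swap ¬cx ¬cb)
                , (λ p c → trans (cong (PC.transpose x b) (kc p c)) (transpose-≢ x b
                            (λ { refl → ¬cx c }) (λ { refl → ¬cb c })))
                , avoid
        where
        b = bs j
        -- If `x` were in the core, `k` would fix it, so `g i₀` itself would be `x`, against `g∉`.
        ¬cx : ¬ Core x
        ¬cx cx = g∉ i₀ (subst Core (sym gi≡x) cx) (here gi≡x)
          where gi≡x = perm-injective k (trans hit (sym (kc x cx)))
        ¬cb : ¬ Core b
        ¬cb cb = bs∉e j (proj₁ (core⊆e cb)) (proj₂ (core⊆e cb))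
        avoid : ∀ i → PC.transpose x b (k ⟨$⟩ʳ g i) ∉ x ∷ xs
        avoid i with k ⟨$⟩ʳ g i ≟ x
        ... | yes kx = bs∉ j
        ... | no k≢x with k ⟨$⟩ʳ g i ≟ b
        ...   | yes k≡b = contradiction k≡b (free i)
        ...   | no _    = λ { (here eq) → k≢x eq ; (there m) → kg i m }

    private
      join : Permutation′ n → Permutation′ n → Permutation′ k
      join h l = actₚ (flip h ∘ₚ l)

    -- For a translate of `z` by a stabiliser element `σ`, take a pattern `h` that agrees with `σ`
    -- on the core. Then the core points among the `h⁻¹ (σ (f i))` are original points `f i`, which
    -- avoid `xs`, and the others are pushed off `xs` by one of the `moves`. The bound on `n` leaves
    -- room for the `d + 1` points `bs` beside the image of `e` and `xs`.
    stabiliser-cover : ∀ (xs : List (Fin n)) (f : Fin d → Fin n) → (∀ i → f i ∉ xs) →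
      suc d ℕ.+ (d ℕ.+ length xs) ≤ n →
      ∀ z (good : Vx → Bool) → (∀ σ → (∀ i → σ ⟨$⟩ʳ f i ∉ xs) → good (act σ z) ≡ true) →
      count k (pairᵇ y z y) ≤ (d ℕ.^ d ℕ.* (2 ℕ.+ d) ℕ.^ length xs) ℕ.* count k (λ b → pairᵇ y z y b ∧ good b)
    stabiliser-cover xs f f∉ big z good h with freshInjection (suc d) (List.tabulate e ++ xs)
      (subst (λ l → suc d ℕ.+ l ≤ n) (sym (trans (List.length-++ (List.tabulate e))
        (cong (ℕ._+ length xs) (List.length-tabulate e)))) big)
    ... | bs , bs-inj , bs∉ = subst (λ l → _ ≤ l ℕ.* _) len (count-cover k gs _ _ cover)
      where
      bs∉e : ∀ j i → e i ≢ bs j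
      bs∉e j i eq = bs∉ j (∈-++⁺ˡ (subst (_∈ List.tabulate e) eq (∈-tabulate⁺ i)))
      ms = moves bs bs-inj bs∉e xs
      gs = cartesianProductWith join patterns ms
      len : length gs ≡ d ℕ.^ d ℕ.* (2 ℕ.+ d) ℕ.^ length xs
      len = trans (length-cartesianProductWith join patterns ms)
                  (cong₂ ℕ._*_ (List.length-tabulate pick) (length-moves bs bs-inj bs∉e xs))
      cover : ∀ b → pairᵇ y z y b ≡ true →
              ∃ λ g → g ∈ gs × (pairᵇ y z y (g ⟨$⟩ʳ b) ∧ good (g ⟨$⟩ʳ b)) ≡ true
      cover b t with pairᵇ⇒ t
      ... | σ , fσ , refl with patterns-cover {σ} fσ
      ...   | h′ , h∈ , fh , agree
            with moves-avoid bs bs-inj bs∉e xs (λ j → bs∉ j ∘ ∈-++⁺ʳ (List.tabulate e))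
                   (λ i → h′ ⟨$⟩ˡ (σ ⟨$⟩ʳ f i)) core∉
        where
        core∉ : ∀ i → Core (h′ ⟨$⟩ˡ (σ ⟨$⟩ʳ f i)) → h′ ⟨$⟩ˡ (σ ⟨$⟩ʳ f i) ∉ xs
        core∉ i c = subst (_∉ xs) (sym (perm-injective σ (trans (sym (agree _ c)) (inverseʳ h′)))) (f∉ i)
      ...     | l , l∈ , fl , _ , l∉ =
        join h′ l , ∈-cartesianProductWith⁺ join h∈ l∈ ,
        ∧-intro (⇒pairᵇ (ρ , act-trans σ (flip h′ ∘ₚ l) fσ (act-trans (flip h′) l (fixes-flip {h′} fh) fl) , ρz))
                (subst (λ v → good v ≡ true) ρz (h ρ l∉))
        where
        ρ = σ ∘ₚ flip h′ ∘ₚ l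
        ρz : act ρ z ≡ act (flip h′ ∘ₚ l) (act σ z)
        ρz = act-∘ σ (flip h′ ∘ₚ l) z

    -- Good neighbours are produced only in the stabiliser orbit of `z`; the factor 2 accounts for
    -- the neighbours that arise by reversing the edge.
    orbitDegree≤good : ∀ (xs : List (Fin n)) (f : Fin d → Fin n) → (∀ i → f i ∉ xs) →
      suc d ℕ.+ (d ℕ.+ length xs) ≤ n →
      ∀ z → Edge (G Γ n) y z → (good : Vx → Bool) → (∀ σ → (∀ i → σ ⟨$⟩ʳ f i ∉ xs) → good (act σ z) ≡ true) →
      orbitDegree Γ n y z ≤ (2 ℕ.* (d ℕ.^ d ℕ.* (2 ℕ.+ d) ℕ.^ length xs)) ℕ.*
        count k (λ u → (adj (G Γ n) y u ∧ orbᵇ y u y z) ∧ good u)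
    orbitDegree≤good xs f f∉ big z yz good h = begin
      orbitDegree Γ n y z              ≤⟨ orbitDegree≤ y z ⟩
      2 ℕ.* count k (pairᵇ y z y)      ≤⟨ ℕₚ.*-monoʳ-≤ 2 (stabiliser-cover xs f f∉ big z good h) ⟩
      2 ℕ.* (M ℕ.* _)                  ≤⟨ ℕₚ.*-monoʳ-≤ 2 (ℕₚ.*-monoʳ-≤ M (count-mono k sub)) ⟩
      2 ℕ.* (M ℕ.* _)                  ≡⟨ ℕₚ.*-assoc 2 M _ ⟨
      (2 ℕ.* M) ℕ.* _                  ∎
      where
      open ℕₚ.≤-Reasoning
      M = d ℕ.^ d ℕ.* (2 ℕ.+ d) ℕ.^ length xs
      sub : ∀ u → (pairᵇ y z y u ∧ good u) ≡ true → ((adj (G Γ n) y u ∧ orbᵇ y u y z) ∧ good u) ≡ true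
      sub u t with ∧-true {pairᵇ y z y u} t
      ... | tp , tg with pairᵇ⇒ tp
      ...   | σ , σy , σz = ∧-intro (∧-intro
              (trans (cong₂ (adj (G Γ n)) (sym σy) (sym σz)) (trans (adj-act σ y z) yz))
              (⇒orbᵇ (flip σ , inj₁ (act-flip σ σy , act-flip σ σz)))) tg

-- Walks of prescribed length

data Walk (H : Graph) : ℕ → Fin (V H) → Fin (V H) → Set where
  []  : ∀ {v} → Walk H 0 v v
  _∷_ : ∀ {l v w x} → Edge H v w → Walk H l w x → Walk H (suc l) v x

mapWalk : ∀ {H H′} (f : Fin (V H) → Fin (V H′)) → (∀ v w → Edge H v w → Edge H′ (f v) (f w)) →
          ∀ {l v w} → Walk H l v w → Walk H′ l (f v) (f w)
mapWalk f hom []      = []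
mapWalk f hom (e ∷ w) = hom _ _ e ∷ mapWalk f hom w

module _ {H : Graph} where

  _++ʷ_ : ∀ {l m u v w} → Walk H l u v → Walk H m v w → Walk H (l ℕ.+ m) u w
  []      ++ʷ q = q
  (e ∷ p) ++ʷ q = e ∷ (p ++ʷ q)

  reverse : ∀ {l v w} → Walk H l v w → Walk H l w v
  reverse []            = []
  reverse {suc l} {v} {w} (_∷_ {w = x} e p) =
    subst (λ i → Walk H i w v) (ℕₚ.+-comm l 1) (reverse p ++ʷ (trans (adj-sym H x v) e ∷ []))

  fromStar : ∀ {v w} → Star (Edge H) v w → ∃ λ l → Walk H l v w
  fromStar Star.ε      = 0 , []
  fromStar (e ◅ es) = suc (proj₁ (fromStar es)) , e ∷ proj₂ (fromStar es)

  bounce : ∀ {v w} → Edge H v w → ∀ j → Walk H (j ℕ.+ j) v v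
  bounce e zero = []
  bounce {v} {w} e (suc j) = subst (λ i → Walk H (suc i) v v) (sym (ℕₚ.+-suc j j))
    (e ∷ (trans (adj-sym H w v) e ∷ bounce e j))

parity : ℕ → Bool
parity zero    = false
parity (suc m) = not (parity m)

parity-odd : ∀ a b → parity a ≡ parity b → parity (a ℕ.+ suc b) ≡ true
parity-odd a b e = trans (parity-+ a (suc b)) (lemma (parity a) (parity b) e)
  where
  lemma : ∀ x y → x ≡ y → (x xor not y) ≡ true
  lemma true  _ refl = refl
  lemma false _ refl = refl
  not-xor : ∀ x y → not (x xor y) ≡ (not x xor y)
  not-xor true  true  = refl
  not-xor true  false = refl
  not-xor false _     = refl
  parity-+ : ∀ a b → parity (a ℕ.+ b) ≡ (parity a xor parity b)
  parity-+ zero    b = refl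
  parity-+ (suc a) b = trans (cong not (parity-+ a b)) (not-xor (parity a) (parity b))

halve : ∀ x → (∃ λ h → x ≡ h ℕ.+ h × parity x ≡ false) ⊎ (∃ λ h → x ≡ suc (h ℕ.+ h) × parity x ≡ true)
halve zero = inj₁ (0 , refl , refl)
halve (suc x) with halve x
... | inj₁ (h , e , p) = inj₂ (h , cong suc e , cong not p)
... | inj₂ (h , e , p) = inj₁ (suc h , cong suc (trans e (sym (ℕₚ.+-suc h h))) , cong not p)

bounded : ∀ k (f : Fin k → ℕ) → ∃ λ m → ∀ x → f x ≤ m
bounded zero    f = 0 , λ ()
bounded (suc k) f with bounded k (f ∘ suc)
... | m , le = f zero ℕ.⊔ m , λ { zero → ℕₚ.m≤m⊔n (f zero) m ; (suc x) → ℕₚ.m≤n⇒m≤o⊔n (f zero) (le x) }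

-- Colour each vertex by the parity of the chosen walk from `r`. As this is no proper 2-colouring,
-- some edge joins vertices of equal parity, and going out along one walk, over that edge and back
-- along the other is a closed walk of odd length.
nonBipartite⇒oddWalk : ∀ H → (∀ v → ∃ λ l → ∀ w → Walk H (l w) v w) → ¬ Bipartite H →
                       Fin (V H) → ∃ λ p → ∃ λ v → Walk H (suc (p ℕ.+ p)) v v
nonBipartite⇒oddWalk H reach nb r with reach r
... | ℓ , walk with any? (λ v → any? (λ w → (adj H v w Bool.≟ true) ×-dec (parity (ℓ v) Bool.≟ parity (ℓ w))))
...   | no ¬odd = contradiction (parity ∘ ℓ , λ v w e c → ¬odd (v , w , e , c)) nb
...   | yes (v , w , e , c) with halve (ℓ v ℕ.+ suc (ℓ w))
...     | inj₁ (_ , _ , even) = contradiction (trans (sym even) (parity-odd (ℓ v) (ℓ w) c)) λ ()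
...     | inj₂ (p , eq , _)   = p , r , subst (λ i → Walk H i r r) eq (walk v ++ʷ (e ∷ reverse (walk w)))

-- Go from `a` to `b` through a base vertex `r`. If the length is odd, insert an odd closed walk at
-- `r`; then fill up to a common even length by going back and forth along an edge at `r`.
exactWalks : ∀ H → Connected H → ¬ Bipartite H → ∃ λ L → ∀ a b → Walk H (suc L) a b
exactWalks H conn nb = go (inhabited? (V H))
  where
  inhabited? : ∀ k → Fin k ⊎ (Fin k → Fin 0)
  inhabited? zero    = inj₂ id
  inhabited? (suc k) = inj₁ zero
  reach : ∀ v → ∃ λ l → ∀ w → Walk H (l w) v w
  reach v = (λ w → proj₁ (fromStar (conn v w))) , λ w → proj₂ (fromStar (conn v w))
  go : Fin (V H) ⊎ (Fin (V H) → Fin 0) → ∃ λ L → ∀ a b → Walk H (suc L) a b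
  -- A graph without vertices is bipartite.
  go (inj₂ empty) = contradiction ((λ _ → true) , λ v → contradiction (empty v) λ ()) nb
  go (inj₁ v₀) with nonBipartite⇒oddWalk H reach nb v₀
  ... | p , r , odd@(e ∷ _) with bounded (V H) (proj₁ (reach r))
  -- The common length is `h⁺ + h⁺`, enough for two walks of length at most `m` and the odd closed
  -- walk of length `2p + 1`. Being a successor, it gives every walk a first edge.
  ...   | m , ℓ≤m = p ℕ.+ p ℕ.+ (m ℕ.+ m) ℕ.+ suc (p ℕ.+ p ℕ.+ (m ℕ.+ m)) , λ a b → through a b (halve (ℓ a ℕ.+ ℓ b))
    where
    ℓ = proj₁ (reach r)
    walk = proj₂ (reach r)
    h⁺ = suc (p ℕ.+ p ℕ.+ (m ℕ.+ m))
    open ℕSolver.+-*-Solver using (solve; con; _:=_; _:+_)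

    through : ∀ a b → _ → Walk H (h⁺ ℕ.+ h⁺) a b
    through a b (inj₁ (h , eq , _)) = subst (λ i → Walk H i a b) len
      (reverse (walk a) ++ʷ (bounce e j ++ʷ walk b))
      where
      j = h⁺ ℕ.∸ h
      h≤ : h ≤ h⁺
      h≤ = ℕₚ.≤-trans (ℕₚ.m≤m+n h h) (ℕₚ.≤-trans (subst (_≤ m ℕ.+ m) eq (ℕₚ.+-mono-≤ (ℓ≤m a) (ℓ≤m b)))
             (ℕₚ.m≤n+m (m ℕ.+ m) (suc (p ℕ.+ p))))
      len : ℓ a ℕ.+ (j ℕ.+ j ℕ.+ ℓ b) ≡ h⁺ ℕ.+ h⁺
      len = begin
        ℓ a ℕ.+ (j ℕ.+ j ℕ.+ ℓ b)      ≡⟨ solve 3 (λ x j y → x :+ (j :+ j :+ y) := (x :+ y) :+ (j :+ j)) refl (ℓ a) j (ℓ b) ⟩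
        (ℓ a ℕ.+ ℓ b) ℕ.+ (j ℕ.+ j)    ≡⟨ cong (ℕ._+ (j ℕ.+ j)) eq ⟩
        (h ℕ.+ h) ℕ.+ (j ℕ.+ j)        ≡⟨ solve 2 (λ h j → (h :+ h) :+ (j :+ j) := (h :+ j) :+ (h :+ j)) refl h j ⟩
        (h ℕ.+ j) ℕ.+ (h ℕ.+ j)        ≡⟨ cong (λ s → s ℕ.+ s) (ℕₚ.m+[n∸m]≡n h≤) ⟩
        h⁺ ℕ.+ h⁺                      ∎
        where open ≡-Reasoning
    through a b (inj₂ (h , eq , _)) = subst (λ i → Walk H i a b) len
      (reverse (walk a) ++ʷ ((odd ++ʷ bounce e j) ++ʷ walk b))
      where
      j = h⁺ ℕ.∸ suc (h ℕ.+ p)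
      h≤ : suc (h ℕ.+ p) ≤ h⁺
      h≤ = s≤s (subst (_≤ p ℕ.+ p ℕ.+ (m ℕ.+ m)) (ℕₚ.+-comm p h) (ℕₚ.+-mono-≤ (ℕₚ.m≤m+n p p)
             (ℕₚ.≤-trans (ℕₚ.m≤m+n h h) (ℕₚ.≤-trans (ℕₚ.n≤1+n (h ℕ.+ h)) (subst (_≤ m ℕ.+ m) eq (ℕₚ.+-mono-≤ (ℓ≤m a) (ℓ≤m b)))))))
      len : ℓ a ℕ.+ (suc (p ℕ.+ p) ℕ.+ (j ℕ.+ j) ℕ.+ ℓ b) ≡ h⁺ ℕ.+ h⁺
      len = begin
        ℓ a ℕ.+ (suc (p ℕ.+ p) ℕ.+ (j ℕ.+ j) ℕ.+ ℓ b)
          ≡⟨ solve 4 (λ x j y p → x :+ (con 1 :+ (p :+ p) :+ (j :+ j) :+ y) := (x :+ y) :+ (con 1 :+ (p :+ p) :+ (j :+ j))) refl (ℓ a) j (ℓ b) p ⟩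
        (ℓ a ℕ.+ ℓ b) ℕ.+ (suc (p ℕ.+ p) ℕ.+ (j ℕ.+ j))
          ≡⟨ cong (ℕ._+ (suc (p ℕ.+ p) ℕ.+ (j ℕ.+ j))) eq ⟩
        suc (h ℕ.+ h) ℕ.+ (suc (p ℕ.+ p) ℕ.+ (j ℕ.+ j))
          ≡⟨ solve 3 (λ h j p → con 1 :+ (h :+ h) :+ (con 1 :+ (p :+ p) :+ (j :+ j)) := (con 1 :+ (h :+ p) :+ j) :+ (con 1 :+ (h :+ p) :+ j)) refl h j p ⟩
        (suc (h ℕ.+ p) ℕ.+ j) ℕ.+ (suc (h ℕ.+ p) ℕ.+ j)
          ≡⟨ cong (λ s → s ℕ.+ s) (ℕₚ.m+[n∸m]≡n h≤) ⟩
        h⁺ ℕ.+ h⁺ ∎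
        where open ≡-Reasoning

-- Presentation of vertices by vertices of bounded level

module Presentation (Γ : FIGraph) (d : ℕ)
  (gen : ∀ n → d ≤ n → ∀ (v : Fin (V (G Γ (suc n)))) →
         ∃ λ (f : Fin n → Fin (suc n)) → Σ (Inj f) λ inj → ∃ λ u → map Γ f inj u ≡ v) where

  present : ∀ {n} → d ≤′ n → (v : Fin (V (G Γ n))) →
            ∃ λ (e : Fin d → Fin n) → Σ (Inj e) λ inj → ∃ λ u → map Γ e inj u ≡ v
  present ≤′-refl v = id , id , v , map-id Γ id v
  present (≤′-step le) v with gen _ (ℕₚ.≤′⇒≤ le) v
  ... | f , f-inj , w , refl with present le w
  ...   | e , e-inj , u , refl = f ∘ e , e-inj ∘ f-inj , u , map-∘ Γ e f e-inj f-inj (e-inj ∘ f-inj) u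

  lift : ∀ {n} (e : Fin d → Fin (suc n)) (inj : Inj e) u r → (∀ i → r ≢ e i) →
         ∃ λ v → map Γ (punchIn r) (λ {i} {j} → punchIn-injective r i j) v ≡ map Γ e inj u
  lift e inj u r r∉ = map Γ e′ inj′ u , trans
    (sym (map-∘ Γ e′ (punchIn r) inj′ (λ {i} {j} → punchIn-injective r i j) (inj′ ∘ punchIn-injective r _ _) u))
    (map-cong Γ _ e (inj′ ∘ punchIn-injective r _ _) inj (λ i → punchIn-punchOut (r∉ i)) u)
    where
    e′ : Fin d → Fin _
    e′ i = punchOut (r∉ i)
    inj′ : Inj e′
    inj′ {i} {j} eq = inj (punchOut-injective (r∉ i) (r∉ j) eq)

  -- Above level `N` the supports of `v` and `w`, at most `2d` points, together miss some point `r`.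
  -- Both vertices then come from one level lower along the same inclusion `punchIn r`.
  presentPair : ∀ {N n} → d ℕ.+ d ≤ N → N ≤′ n → (v w : Fin (V (G Γ n))) →
                ∃ λ (g : Fin N → Fin n) → Σ (Inj g) λ inj → ∃ λ a → ∃ λ b → map Γ g inj a ≡ v × map Γ g inj b ≡ w
  presentPair 2d≤N ≤′-refl v w = id , id , v , w , map-id Γ id v , map-id Γ id w
  presentPair {N} {suc n} 2d≤N (≤′-step N≤n) v w
    with present (ℕₚ.≤⇒≤′ d≤n) v | present (ℕₚ.≤⇒≤′ d≤n) w
    where d≤n = ℕₚ.≤-trans (ℕₚ.m≤m+n d d) (ℕₚ.≤-trans 2d≤N (ℕₚ.m≤n⇒m≤1+n (ℕₚ.≤′⇒≤ N≤n)))
  ... | e , e-inj , u , refl | e′ , e′-inj , u′ , refl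
    with fresh (List.tabulate e ++ List.tabulate e′) (subst (_< suc n)
           (sym (trans (List.length-++ (List.tabulate e)) (cong₂ ℕ._+_ (List.length-tabulate e) (List.length-tabulate e′))))
           (s≤s (ℕₚ.≤-trans 2d≤N (ℕₚ.≤′⇒≤ N≤n))))
  ...   | r , r∉ with lift e e-inj u r (λ i eq → r∉ (subst (_∈ _) (sym eq) (∈-++⁺ˡ (∈-tabulate⁺ i))))
                    | lift e′ e′-inj u′ r (λ i eq → r∉ (subst (_∈ _) (sym eq) (∈-++⁺ʳ (List.tabulate e) (∈-tabulate⁺ i))))
  ...     | v₁ , ev | w₁ , ew with presentPair 2d≤N N≤n v₁ w₁
  ...       | g , g-inj , a , b , refl , refl = punchIn r ∘ g , g-inj ∘ punchIn-injective r _ _ , a , b ,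
              trans (map-∘ Γ g (punchIn r) g-inj (λ {i} {j} → punchIn-injective r i j) (g-inj ∘ punchIn-injective r _ _) a) ev ,
              trans (map-∘ Γ g (punchIn r) g-inj (λ {i} {j} → punchIn-injective r i j) (g-inj ∘ punchIn-injective r _ _) b) ew

-- Edge orbits at a vertex: representatives and a bound on their number

module Orbits (Γ : FIGraph) (n : ℕ) where
  open Action Γ n

  private
    k = V (G Γ n)
    A = adj (G Γ n)

  orbitDegree-cong : ∀ {y z w} → Orbit y z y w → orbitDegree Γ n y z ≡ orbitDegree Γ n y w
  orbitDegree-cong {y} {z} {w} o = trans (orbitDegree≡ y z) (trans (count-cong k λ u → cong (A y u ∧_)
    (iff⇒≡ (λ t → ⇒orbᵇ (orbit-trans (orbᵇ⇒ t) o)) (λ t → ⇒orbᵇ (orbit-trans (orbᵇ⇒ t) (orbit-sym o)))))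
    (sym (orbitDegree≡ y w)))

  orbitDegree-act : ∀ σ y z → orbitDegree Γ n (act σ y) (act σ z) ≡ orbitDegree Γ n y z
  orbitDegree-act σ y z = trans (orbitDegree≡ (act σ y) (act σ z)) (trans (count-permute k _ (actₚ σ))
    (trans (count-cong k λ u → cong₂ _∧_ (adj-act σ y u) (iff⇒≡
      (λ t → ⇒orbᵇ (orbit-trans (orbit-act σ) (orbit-trans (orbᵇ⇒ t) (orbit-sym (orbit-act σ)))))
      (λ t → ⇒orbᵇ (orbit-trans (orbit-sym (orbit-act σ)) (orbit-trans (orbᵇ⇒ t) (orbit-act σ))))))
    (sym (orbitDegree≡ y z))))

  1≤orbitDegree : ∀ {y z} → Edge (G Γ n) y z → 1 ≤ orbitDegree Γ n y z
  1≤orbitDegree {y} {z} e = subst (1 ≤_) (sym (orbitDegree≡ y z))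
    (count-pos k (λ u → A y u ∧ orbᵇ y u y z) z (∧-intro e (⇒orbᵇ orbit-refl)))

  -- The condition that `orbitsAt` counts; it selects exactly one neighbour from each edge orbit at
  -- `v`.
  First : Fin k → Fin k → Set
  First v u = A v u ≡ true × (∀ u′ → u′ Fin.< u → A v u′ ≡ true → ¬ Orbit v u′ v u)

  abstract
    earlier? : ∀ v u → Dec (∃ λ u′ → u′ Fin.< u × A v u′ ≡ true × SameOrbit Γ n v u′ v u)
    earlier? v u = any? λ u′ → (u′ Fin.<? u) ×-dec (A v u′ Bool.≟ true) ×-dec sameOrbit? Γ n v u′ v u

    firstᵇ : Fin k → Fin k → Bool
    firstᵇ v u = A v u ∧ not (does (earlier? v u))

    orbitsAt≡ : ∀ v → orbitsAt Γ n v ≡ count k (firstᵇ v)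
    orbitsAt≡ v = refl

    firstᵇ⇒ : ∀ {v u} → firstᵇ v u ≡ true → First v u
    firstᵇ⇒ {v} {u} t = proj₁ (∧-true {A v u} t) , λ u′ lt e′ o →
      contradiction (trans (sym (cong not (dec-true (earlier? v u) (u′ , lt , e′ , orbit⇒sameOrbit o))))
                           (proj₂ (∧-true {A v u} t))) λ ()

    ⇒firstᵇ : ∀ {v u} → First v u → firstᵇ v u ≡ true
    ⇒firstᵇ {v} {u} (e , min) = ∧-intro e (cong not (dec-false (earlier? v u)
      λ { (u′ , lt , e′ , o) → min u′ lt e′ (sameOrbit⇒orbit o) }))

  first-unique : ∀ {v u w} → First v u → First v w → Orbit v u v w → u ≡ w
  first-unique {v} {u} {w} (eu , mu) (ew , mw) o with <-cmp u w
  ... | tri< lt _ _ = contradiction o (mw u lt eu)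
  ... | tri≈ _ eq _ = eq
  ... | tri> _ _ gt = contradiction (orbit-sym o) (mu w gt ew)

  first-exists : ∀ {v w} → Edge (G Γ n) v w → ∃ λ u → First v u × Orbit v w v u
  first-exists {v} {w} e with least k (λ u → A v u ∧ orbᵇ v u v w) w (∧-intro e (⇒orbᵇ orbit-refl))
  ... | u , t , min with ∧-true {A v u} t
  ...   | eu , ou = u , (eu , λ u′ lt e′ o → min u′ lt (∧-intro e′ (⇒orbᵇ (orbit-trans o (orbᵇ⇒ ou))))) , orbit-sym (orbᵇ⇒ ou)

  1≤orbitsAt : ∀ {v w} → Edge (G Γ n) v w → 1 ≤ orbitsAt Γ n v
  1≤orbitsAt {v} e with first-exists e
  ... | u , f , _ = subst (1 ≤_) (sym (orbitsAt≡ v)) (count-pos k (firstᵇ v) u (⇒firstᵇ f))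

  Presented : ℕ → Fin k → Fin k → Set
  Presented N v w = ∃ λ (g : Fin N → Fin n) → Σ (Inj g) λ inj → ∃ λ a → ∃ λ b →
                    map Γ g inj a ≡ v × map Γ g inj b ≡ w

  source : ∀ {N v w} → Presented N v w → Fin (V (G Γ N)) × Fin (V (G Γ N))
  source (_ , _ , a , b , _) = a , b

  source-orbit : ∀ {N v u w} (p : Presented N v u) (q : Presented N v w) → source p ≡ source q → Orbit v u v w
  source-orbit {N} (g , inj , a , b , ga , gb) (g′ , inj′ , .a , .b , ga′ , gb′) refl with extend N g g′ inj inj′
  ... | σ , ext , _ = σ , inj₁
    ( trans (cong (act σ) (sym ga)) (trans (act-map σ inj inj′ ext a) ga′)
    , trans (cong (act σ) (sym gb)) (trans (act-map σ inj inj′ ext b) gb′))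

  -- Each first neighbour `u` is labelled by the pair of vertices at level `N` that presents `v` and
  -- `u`. Equal labels differ only in the injection, which a permutation corrects, so the edges lie
  -- in one orbit and the first neighbours coincide.
  orbitsAt≤ : ∀ {N} → (∀ v w → Presented N v w) → ∀ v → orbitsAt Γ n v ≤ V (G Γ N) ℕ.* V (G Γ N)
  orbitsAt≤ {N} pres v = subst (_≤ K ℕ.* K) (sym (orbitsAt≡ v)) (count-injective k (K ℕ.* K) (firstᵇ v) ix
    λ u w fu fw eq → first-unique (firstᵇ⇒ fu) (firstᵇ⇒ fw) (source-orbit (pres v u) (pres v w) (same u w eq)))
    where
    K = V (G Γ N)
    ix : Fin k → Fin (K ℕ.* K)
    ix u = combine (proj₁ (source (pres v u))) (proj₂ (source (pres v u)))
    same : ∀ u w → ix u ≡ ix w → source (pres v u) ≡ source (pres v w)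
    same u w eq = let e₁ , e₂ = combine-injective (proj₁ (source (pres v u))) _ (proj₁ (source (pres v w))) _ eq
                  in cong₂ _,_ e₁ e₂

-- Order and arithmetic in the rationals

open ℚSolver.+-*-Solver using (solve; con; _:=_; _:+_; _:*_; _:-_; :-_)

*-monoˡ : ∀ {r p q} → 0ℚ ℚ.≤ r → p ℚ.≤ q → r * p ℚ.≤ r * q
*-monoˡ {r} 0≤r = ℚₚ.*-monoˡ-≤-nonNeg r {{ℚ.nonNegative 0≤r}}

*-monoʳ : ∀ {r p q} → 0ℚ ℚ.≤ r → p ℚ.≤ q → p * r ℚ.≤ q * r
*-monoʳ {r} 0≤r = ℚₚ.*-monoʳ-≤-nonNeg r {{ℚ.nonNegative 0≤r}}

0≤* : ∀ {p q} → 0ℚ ℚ.≤ p → 0ℚ ℚ.≤ q → 0ℚ ℚ.≤ p * q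
0≤* {p} {q} 0≤p 0≤q = subst (ℚ._≤ p * q) (ℚₚ.*-zeroʳ p) (*-monoˡ 0≤p 0≤q)

0≤1 : 0ℚ ℚ.≤ 1ℚ
0≤1 = ℚₚ.nonNegative⁻¹ 1ℚ

0≤+ : ∀ {p q} → 0ℚ ℚ.≤ p → 0ℚ ℚ.≤ q → 0ℚ ℚ.≤ p + q
0≤+ = ℚₚ.+-mono-≤

p≤q⇒0≤q-p : ∀ {p q} → p ℚ.≤ q → 0ℚ ℚ.≤ q - p
p≤q⇒0≤q-p {p} {q} p≤q = subst (ℚ._≤ q - p) (ℚₚ.+-inverseʳ p) (ℚₚ.+-monoˡ-≤ (- p) p≤q)

-- The embedding of ℕ in ℚ

⟦_⟧ : ℕ → ℚ
⟦ zero ⟧  = 0ℚ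
⟦ suc m ⟧ = 1ℚ + ⟦ m ⟧

⟦⟧-+ : ∀ a b → ⟦ a ℕ.+ b ⟧ ≡ ⟦ a ⟧ + ⟦ b ⟧
⟦⟧-+ zero    b = sym (ℚₚ.+-identityˡ ⟦ b ⟧)
⟦⟧-+ (suc a) b = trans (cong (1ℚ +_) (⟦⟧-+ a b)) (sym (ℚₚ.+-assoc 1ℚ ⟦ a ⟧ ⟦ b ⟧))

⟦⟧-* : ∀ a b → ⟦ a ℕ.* b ⟧ ≡ ⟦ a ⟧ * ⟦ b ⟧
⟦⟧-* zero    b = sym (ℚₚ.*-zeroˡ ⟦ b ⟧)
⟦⟧-* (suc a) b = trans (⟦⟧-+ b (a ℕ.* b)) (trans (cong (⟦ b ⟧ +_) (⟦⟧-* a b))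
  (solve 2 (λ x y → y :+ x :* y := (con 1ℚ :+ x) :* y) refl ⟦ a ⟧ ⟦ b ⟧))

0≤⟦⟧ : ∀ a → 0ℚ ℚ.≤ ⟦ a ⟧
0≤⟦⟧ zero    = ℚₚ.≤-refl
0≤⟦⟧ (suc a) = 0≤+ 0≤1 (0≤⟦⟧ a)

⟦⟧-mono : ∀ {a b} → a ℕ.≤ b → ⟦ a ⟧ ℚ.≤ ⟦ b ⟧
⟦⟧-mono {b = b} z≤n = 0≤⟦⟧ b
⟦⟧-mono (s≤s h)     = ℚₚ.+-monoʳ-≤ 1ℚ (⟦⟧-mono h)

⟦⟧-/ : ∀ m → ⟦ m ⟧ ≡ ℤ.+ m ℚ./ 1
⟦⟧-/ zero    = refl
⟦⟧-/ (suc m) = ℚₚ.toℚᵘ-injective (begin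
  ℚ.toℚᵘ (1ℚ + ⟦ m ⟧)                 ≈⟨ ℚₚ.toℚᵘ-homo-+ 1ℚ ⟦ m ⟧ ⟩
  ℚ.toℚᵘ 1ℚ ℚᵘ.+ ℚ.toℚᵘ ⟦ m ⟧         ≈⟨ ℚᵘₚ.+-congʳ (ℚ.toℚᵘ 1ℚ) (ℚᵘₚ.≃-trans (ℚᵘₚ.≃-reflexive (cong ℚ.toℚᵘ (⟦⟧-/ m))) (ℚₚ.toℚᵘ-fromℚᵘ (mkℚᵘ (ℤ.+ m) 0))) ⟩
  ℚ.toℚᵘ 1ℚ ℚᵘ.+ mkℚᵘ (ℤ.+ m) 0         ≈⟨ ℚᵘ.*≡* (cong (ℤ._* ℤ.+ 1) (cong (λ i → ℤ.+ 1 ℤ.+ i) (ℤₚ.*-identityʳ (ℤ.+ m)))) ⟩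
  mkℚᵘ (ℤ.+ suc m) 0                    ≈⟨ ℚₚ.toℚᵘ-fromℚᵘ (mkℚᵘ (ℤ.+ suc m) 0) ⟨
  ℚ.toℚᵘ (ℤ.+ suc m ℚ./ 1)              ∎)
  where open ℚᵘₚ.≃-Reasoning

⟦⟧*recip : ∀ {m} → 1 ℕ.≤ m → ⟦ m ⟧ * recip m ≡ 1ℚ
⟦⟧*recip {suc m} _ = ℚₚ.toℚᵘ-injective (begin
  ℚ.toℚᵘ (⟦ suc m ⟧ * recip (suc m))               ≈⟨ ℚₚ.toℚᵘ-homo-* ⟦ suc m ⟧ (recip (suc m)) ⟩
  ℚ.toℚᵘ ⟦ suc m ⟧ ℚᵘ.* ℚ.toℚᵘ (recip (suc m))
    ≈⟨ ℚᵘₚ.*-cong (ℚᵘₚ.≃-trans (ℚᵘₚ.≃-reflexive (cong ℚ.toℚᵘ (⟦⟧-/ (suc m)))) (ℚₚ.toℚᵘ-fromℚᵘ (mkℚᵘ (ℤ.+ suc m) 0)))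
                  (ℚₚ.toℚᵘ-fromℚᵘ (mkℚᵘ (ℤ.+ 1) m)) ⟩
  mkℚᵘ (ℤ.+ suc m) 0 ℚᵘ.* mkℚᵘ (ℤ.+ 1) m
    ≈⟨ ℚᵘ.*≡* (trans (ℤₚ.*-identityʳ _) (trans (ℤₚ.*-identityʳ (ℤ.+ suc m))
         (sym (trans (ℤₚ.*-identityˡ _) (cong ℤ.+_ (ℕₚ.+-identityʳ (suc m))))))) ⟩
  ℚ.toℚᵘ 1ℚ                                        ∎)
  where open ℚᵘₚ.≃-Reasoning

0≤recip : ∀ m → 0ℚ ℚ.≤ recip m
0≤recip zero    = ℚₚ.≤-refl
0≤recip (suc m) = ℚₚ.nonNegative⁻¹ (recip (suc m)) {{ℚₚ.normalize-nonNeg 1 (suc m)}}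

≤-recip : ∀ {m p} → 1 ℕ.≤ m → ⟦ m ⟧ * p ℚ.≤ 1ℚ → p ℚ.≤ recip m
≤-recip {m} {p} 1≤m h = begin
  p                      ≡⟨ ℚₚ.*-identityˡ p ⟨
  1ℚ * p                 ≡⟨ cong (_* p) (trans (ℚₚ.*-comm (recip m) ⟦ m ⟧) (⟦⟧*recip 1≤m)) ⟨
  recip m * ⟦ m ⟧ * p    ≡⟨ ℚₚ.*-assoc (recip m) ⟦ m ⟧ p ⟩
  recip m * (⟦ m ⟧ * p)  ≤⟨ *-monoˡ (0≤recip m) h ⟩
  recip m * 1ℚ           ≡⟨ ℚₚ.*-identityʳ (recip m) ⟩
  recip m                ∎
  where open ℚₚ.≤-Reasoning

recip-≤ : ∀ {m p} → 1 ℕ.≤ m → 1ℚ ℚ.≤ p * ⟦ m ⟧ → recip m ℚ.≤ p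
recip-≤ {m} {p} 1≤m h = begin
  recip m                ≡⟨ ℚₚ.*-identityˡ (recip m) ⟨
  1ℚ * recip m           ≤⟨ *-monoʳ (0≤recip m) h ⟩
  p * ⟦ m ⟧ * recip m    ≡⟨ ℚₚ.*-assoc p ⟦ m ⟧ (recip m) ⟩
  p * (⟦ m ⟧ * recip m)  ≡⟨ cong (p *_) (⟦⟧*recip 1≤m) ⟩
  p * 1ℚ                 ≡⟨ ℚₚ.*-identityʳ p ⟩
  p                      ∎
  where open ℚₚ.≤-Reasoning

recip-anti : ∀ {a b} → 1 ℕ.≤ a → a ℕ.≤ b → recip b ℚ.≤ recip a
recip-anti {a} {b} 1≤a a≤b = ≤-recip 1≤a (begin
  ⟦ a ⟧ * recip b  ≤⟨ *-monoʳ (0≤recip b) (⟦⟧-mono a≤b) ⟩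
  ⟦ b ⟧ * recip b  ≡⟨ ⟦⟧*recip (ℕₚ.≤-trans 1≤a a≤b) ⟩
  1ℚ               ∎)
  where open ℚₚ.≤-Reasoning

-- Finite sums

sumℚ≡sum : ∀ k (f : Fin k → ℚ) → sumℚ k f ≡ Σℚ.sum f
sumℚ≡sum zero    f = refl
sumℚ≡sum (suc k) f = cong (f zero +_) (sumℚ≡sum k (f ∘ suc))

sum-cong : ∀ k {f g : Fin k → ℚ} → (∀ x → f x ≡ g x) → sumℚ k f ≡ sumℚ k g
sum-cong zero    h = refl
sum-cong (suc k) h = cong₂ _+_ (h zero) (sum-cong k (h ∘ suc))

sum-mono : ∀ k {f g : Fin k → ℚ} → (∀ x → f x ℚ.≤ g x) → sumℚ k f ℚ.≤ sumℚ k g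
sum-mono zero    h = ℚₚ.≤-refl
sum-mono (suc k) h = ℚₚ.+-mono-≤ (h zero) (sum-mono k (h ∘ suc))

sum-0 : ∀ k → sumℚ k (λ _ → 0ℚ) ≡ 0ℚ
sum-0 zero    = refl
sum-0 (suc k) = trans (ℚₚ.+-identityˡ _) (sum-0 k)

0≤sum : ∀ k {f : Fin k → ℚ} → (∀ x → 0ℚ ℚ.≤ f x) → 0ℚ ℚ.≤ sumℚ k f
0≤sum k {f} h = subst (ℚ._≤ sumℚ k f) (sum-0 k) (sum-mono k h)

sum-*ˡ : ∀ k c (f : Fin k → ℚ) → sumℚ k (λ x → c * f x) ≡ c * sumℚ k f
sum-*ˡ k c f = trans (sumℚ≡sum k _) (sym (trans (cong (c *_) (sumℚ≡sum k f)) (Σℚ.*-distribˡ-sum c f)))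

sum-*ʳ : ∀ k c (f : Fin k → ℚ) → sumℚ k (λ x → f x * c) ≡ sumℚ k f * c
sum-*ʳ k c f = trans (sum-cong k (λ x → ℚₚ.*-comm (f x) c)) (trans (sum-*ˡ k c f) (ℚₚ.*-comm c _))

sum-+ : ∀ k (f g : Fin k → ℚ) → sumℚ k (λ x → f x + g x) ≡ sumℚ k f + sumℚ k g
sum-+ k f g = trans (sumℚ≡sum k _) (trans (Σℚ.∑-distrib-+ f g)
  (cong₂ _+_ (sym (sumℚ≡sum k f)) (sym (sumℚ≡sum k g))))

sum-neg : ∀ k (f : Fin k → ℚ) → sumℚ k (λ x → - f x) ≡ - sumℚ k f
sum-neg zero    f = refl
sum-neg (suc k) f = trans (cong (- f zero +_) (sum-neg k (f ∘ suc))) (sym (ℚₚ.neg-distrib-+ (f zero) _))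

sum-- : ∀ k (f g : Fin k → ℚ) → sumℚ k (λ x → f x - g x) ≡ sumℚ k f - sumℚ k g
sum-- k f g = trans (sum-+ k f (-_ ∘ g)) (cong (sumℚ k f +_) (sum-neg k g))

sum-comm : ∀ k l (f : Fin k → Fin l → ℚ) →
           sumℚ k (λ x → sumℚ l (f x)) ≡ sumℚ l (λ y → sumℚ k (λ x → f x y))
sum-comm k l f = begin
  sumℚ k (λ x → sumℚ l (f x))            ≡⟨ sum-cong k (λ x → sumℚ≡sum l (f x)) ⟩
  sumℚ k (λ x → Σℚ.sum (f x))            ≡⟨ sumℚ≡sum k _ ⟩
  Σℚ.sum (λ x → Σℚ.sum (f x))            ≡⟨ Σℚ.∑-comm f ⟩
  Σℚ.sum (λ y → Σℚ.sum (λ x → f x y))    ≡⟨ sumℚ≡sum l _ ⟨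
  sumℚ l (λ y → Σℚ.sum (λ x → f x y))    ≡⟨ sum-cong l (λ y → sumℚ≡sum k (λ x → f x y)) ⟨
  sumℚ l (λ y → sumℚ k (λ x → f x y))    ∎
  where open ≡-Reasoning

sum-permute : ∀ k (f : Fin k → ℚ) (π : Permutation′ k) → sumℚ k f ≡ sumℚ k (f ∘ (π ⟨$⟩ʳ_))
sum-permute k f π = trans (sumℚ≡sum k f) (trans (Σℚ.sum-permute f π) (sym (sumℚ≡sum k _)))

sum-if : ∀ k (p : Fin k → Bool) c → sumℚ k (λ x → if p x then c else 0ℚ) ≡ ⟦ count k p ⟧ * c
sum-if zero    p c = sym (ℚₚ.*-zeroˡ c)
sum-if (suc k) p c with p zero
... | true  = trans (cong (λ s → c + s) (sum-if k (p ∘ suc) c))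
                    (solve 2 (λ x y → y :+ x :* y := (con 1ℚ :+ x) :* y) refl ⟦ count k (p ∘ suc) ⟧ c)
... | false = trans (ℚₚ.+-identityˡ _) (sum-if k (p ∘ suc) c)

δ : ∀ {k} → Fin k → Fin k → ℚ
δ v x = if does (x ≟ v) then 1ℚ else 0ℚ

sum-δ : ∀ k v (φ : Fin k → ℚ) → sumℚ k (λ x → δ v x * φ x) ≡ φ v
sum-δ (suc k) zero    φ = trans (cong₂ _+_ (ℚₚ.*-identityˡ (φ zero))
  (trans (sum-cong k (λ x → ℚₚ.*-zeroˡ (φ (suc x)))) (sum-0 k))) (ℚₚ.+-identityʳ (φ zero))
sum-δ (suc k) (suc v) φ = trans (cong (_+ sumℚ k (λ x → δ v x * φ (suc x))) (ℚₚ.*-zeroˡ (φ zero)))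
  (trans (ℚₚ.+-identityˡ (sumℚ k (λ x → δ v x * φ (suc x)))) (sum-δ k v (φ ∘ suc)))

minimum : ∀ k (φ : Fin k → ℚ) → Fin k → ∃ λ x → ∀ y → φ x ℚ.≤ φ y
minimum 1             φ _ = zero , λ { zero → ℚₚ.≤-refl }
minimum (suc (suc k)) φ _ with minimum (suc k) (φ ∘ suc) zero
... | x , min with ℚₚ.≤-total (φ zero) (φ (suc x))
...   | inj₁ le = zero  , λ { zero → ℚₚ.≤-refl ; (suc y) → ℚₚ.≤-trans le (min y) }
...   | inj₂ ge = suc x , λ { zero → ge ; (suc y) → min y }

pow : ℚ → ℕ → ℚ
pow β zero    = 1ℚ
pow β (suc j) = β * pow β j

0≤pow : ∀ {β} → 0ℚ ℚ.≤ β → ∀ j → 0ℚ ℚ.≤ pow β j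
0≤pow 0≤β zero    = 0≤1
0≤pow 0≤β (suc j) = 0≤* 0≤β (0≤pow 0≤β j)

-- Kernels: laws after `t` steps and the dual action on functions

module Kernel {k : ℕ} (P : Fin k → Fin k → ℚ) where

  push : (Fin k → ℚ) → (Fin k → ℚ)
  push μ x = sumℚ k λ y → μ y * P y x

  dist : ℕ → Fin k → (Fin k → ℚ)
  dist zero    v = δ v
  dist (suc t) v = push (dist t v)

  -- The dual of `push`: for a Markov kernel, `pulls t φ y` is the expectation of `φ` after `t`
  -- steps from `y`.
  pull : (Fin k → ℚ) → (Fin k → ℚ)
  pull φ y = sumℚ k λ x → P y x * φ x

  pulls : ℕ → (Fin k → ℚ) → (Fin k → ℚ)
  pulls zero    φ = φ
  pulls (suc t) φ = pull (pulls t φ)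

  pull-cong : ∀ {φ ψ} → (∀ x → φ x ≡ ψ x) → ∀ y → pull φ y ≡ pull ψ y
  pull-cong h y = sum-cong k λ x → cong (P y x *_) (h x)

  pulls-pull : ∀ t φ y → pulls t (pull φ) y ≡ pull (pulls t φ) y
  pulls-pull zero    φ y = refl
  pulls-pull (suc t) φ y = pull-cong (pulls-pull t φ) y

  pulls-+ : ∀ s t φ y → pulls (s ℕ.+ t) φ y ≡ pulls s (pulls t φ) y
  pulls-+ zero    t φ y = refl
  pulls-+ (suc s) t φ y = pull-cong (pulls-+ s t φ) y

  dual : ∀ μ φ → sumℚ k (λ x → push μ x * φ x) ≡ sumℚ k (λ y → μ y * pull φ y)
  dual μ φ = begin
    sumℚ k (λ x → push μ x * φ x)
      ≡⟨ sum-cong k (λ x → sum-*ʳ k (φ x) (λ y → μ y * P y x)) ⟨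
    sumℚ k (λ x → sumℚ k λ y → μ y * P y x * φ x)
      ≡⟨ sum-comm k k _ ⟩
    sumℚ k (λ y → sumℚ k λ x → μ y * P y x * φ x)
      ≡⟨ sum-cong k (λ y → trans (sum-cong k (λ x → ℚₚ.*-assoc (μ y) (P y x) (φ x))) (sum-*ˡ k (μ y) _)) ⟩
    sumℚ k (λ y → μ y * pull φ y) ∎
    where open ≡-Reasoning

  dist-pulls : ∀ t v φ → sumℚ k (λ x → dist t v x * φ x) ≡ pulls t φ v
  dist-pulls zero    v φ = sum-δ k v φ
  dist-pulls (suc t) v φ = trans (dual (dist t v) φ) (trans (dist-pulls t v (pull φ)) (pulls-pull t φ v))

  module Nonneg (P≥0 : ∀ y x → 0ℚ ℚ.≤ P y x) where

    0≤dist : ∀ t v x → 0ℚ ℚ.≤ dist t v x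
    0≤dist zero v x with x ≟ v
    ... | yes _ = 0≤1
    ... | no _  = ℚₚ.≤-refl
    0≤dist (suc t) v x = 0≤sum k λ y → 0≤* (0≤dist t v y) (P≥0 y x)

    0≤pulls : ∀ {φ} → (∀ x → 0ℚ ℚ.≤ φ x) → ∀ t y → 0ℚ ℚ.≤ pulls t φ y
    0≤pulls h zero    y = h y
    0≤pulls h (suc t) y = 0≤sum k λ x → 0≤* (P≥0 y x) (0≤pulls h t x)

-- Transfers lower bounds to the walk from a smaller kernel that may lose mass at each step.
dist-mono : ∀ {k} {Q P : Fin k → Fin k → ℚ} → (∀ y x → 0ℚ ℚ.≤ Q y x) → (∀ y x → Q y x ℚ.≤ P y x) →
            ∀ t v x → Kernel.dist Q t v x ℚ.≤ Kernel.dist P t v x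
dist-mono Q≥0 Q≤P zero    v x = ℚₚ.≤-refl
dist-mono {k} {Q} {P} Q≥0 Q≤P (suc t) v x = sum-mono k λ y →
  ℚₚ.≤-trans (*-monoʳ (Q≥0 y x) (dist-mono Q≥0 Q≤P t v y))
             (*-monoˡ (Kernel.Nonneg.0≤dist P (λ y x → ℚₚ.≤-trans (Q≥0 y x) (Q≤P y x)) t v y) (Q≤P y x))

-- Doeblin's argument: contraction of oscillation

module Contraction {k : ℕ} (P : Fin k → Fin k → ℚ) (P≥0 : ∀ y x → 0ℚ ℚ.≤ P y x)
  (rows : ∀ y → sumℚ k (P y) ≡ 1ℚ) (L : ℕ) (c : ℚ) (c≤1 : c ℚ.≤ 1ℚ)
  (minorant : ∀ v v′ → ∃ λ (m : Fin k → ℚ) → (∀ x → m x ℚ.≤ Kernel.dist P L v x) ×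
                       (∀ x → m x ℚ.≤ Kernel.dist P L v′ x) × c ℚ.≤ sumℚ k m) where
  open Kernel P

  pull-1 : ∀ y → pull (λ _ → 1ℚ) y ≡ 1ℚ
  pull-1 y = trans (sum-cong k (λ x → ℚₚ.*-identityʳ (P y x))) (rows y)

  pulls-1 : ∀ t y → pulls t (λ _ → 1ℚ) y ≡ 1ℚ
  pulls-1 zero    y = refl
  pulls-1 (suc t) y = trans (pull-cong (pulls-1 t) y) (pull-1 y)

  dist-total : ∀ t v → sumℚ k (dist t v) ≡ 1ℚ
  dist-total t v = trans (sum-cong k (λ x → sym (ℚₚ.*-identityʳ (dist t v x))))
    (trans (dist-pulls t v (λ _ → 1ℚ)) (pulls-1 t v))

  Osc : (Fin k → ℚ) → ℚ → Set
  Osc φ o = ∀ v v′ → φ v - φ v′ ℚ.≤ o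

  weighted-≤ : ∀ (a φ : Fin k → ℚ) u → (∀ x → 0ℚ ℚ.≤ a x) → (∀ x → φ x ℚ.≤ u) →
               sumℚ k (λ x → a x * φ x) ℚ.≤ sumℚ k a * u
  weighted-≤ a φ u a≥0 h = subst (sumℚ k (λ x → a x * φ x) ℚ.≤_) (sum-*ʳ k u a)
    (sum-mono k λ x → *-monoˡ (a≥0 x) (h x))

  weighted-≥ : ∀ (a φ : Fin k → ℚ) l → (∀ x → 0ℚ ℚ.≤ a x) → (∀ x → l ℚ.≤ φ x) →
               sumℚ k a * l ℚ.≤ sumℚ k (λ x → a x * φ x)
  weighted-≥ a φ l a≥0 h = subst (ℚ._≤ sumℚ k (λ x → a x * φ x)) (sum-*ʳ k l a)
    (sum-mono k λ x → *-monoˡ (a≥0 x) (h x))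

  -- Remove the common part `m` from both laws: its contributions cancel. What remains is
  -- nonnegative of mass `s ≤ 1 - c` on either side, so both integrals of `φ` lie between `s * φ x₀`
  -- and `s * (φ x₀ + o)`, where `x₀` minimises `φ`.
  osc-contract : ∀ φ o → 0ℚ ℚ.≤ o → Osc φ o → Osc (pulls L φ) ((1ℚ - c) * o)
  osc-contract φ o 0≤o osc v v′ = begin
    pulls L φ v - pulls L φ v′
      ≡⟨ cong₂ _-_ (split v) (split v′) ⟩
    (rest v + mφ) - (rest v′ + mφ)
      ≡⟨ cancel (rest v) (rest v′) mφ ⟩
    rest v - rest v′
      ≤⟨ ℚₚ.+-mono-≤ {rest v} {s * (φ x₀ + o)} { - rest v′} { - (s * φ x₀)} above
           (ℚₚ.neg-antimono-≤ {s * φ x₀} {rest v′} below) ⟩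
    s * (φ x₀ + o) - s * φ x₀
      ≡⟨ gap s (φ x₀) o ⟩
    s * o
      ≤⟨ *-monoʳ 0≤o (ℚₚ.+-monoʳ-≤ 1ℚ (ℚₚ.neg-antimono-≤ c≤m)) ⟩
    (1ℚ - c) * o ∎
    where
    open ℚₚ.≤-Reasoning
    cancel : ∀ a b m → (a + m) - (b + m) ≡ a - b
    cancel = solve 3 (λ a b m → (a :+ m) :- (b :+ m) := a :- b) refl
    gap : ∀ s l o → s * (l + o) - s * l ≡ s * o
    gap = solve 3 (λ s l o → s :* (l :+ o) :- s :* l := s :* o) refl
    part : ∀ d m p → d * p ≡ (d - m) * p + m * p
    part = solve 3 (λ d m p → d :* p := (d :- m) :* p :+ m :* p) refl
    back : ∀ a b → a ≡ b + (a - b)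
    back = solve 2 (λ a b → a := b :+ (a :- b)) refl
    m : Fin k → ℚ
    m = proj₁ (minorant v v′)
    m≤ = proj₁ (proj₂ (minorant v v′))
    m≤′ = proj₁ (proj₂ (proj₂ (minorant v v′)))
    c≤m = proj₂ (proj₂ (proj₂ (minorant v v′)))
    x₀ : Fin k
    x₀ = proj₁ (minimum k φ v)
    min = proj₂ (minimum k φ v)
    mφ s : ℚ
    mφ = sumℚ k (λ x → m x * φ x)
    s = 1ℚ - sumℚ k m
    excess : Fin k → Fin k → ℚ
    excess v x = dist L v x - m x
    rest : Fin k → ℚ
    rest v = sumℚ k (λ x → excess v x * φ x)
    split : ∀ v → pulls L φ v ≡ rest v + mφ
    split v = trans (sym (dist-pulls L v φ)) (trans
      (sum-cong k (λ x → part (dist L v x) (m x) (φ x)))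
      (sum-+ k (λ x → excess v x * φ x) (λ x → m x * φ x)))
    mass : ∀ v → sumℚ k (excess v) ≡ s
    mass v = trans (sum-- k (dist L v) m) (cong (_- sumℚ k m) (dist-total L v))
    upper : ∀ x → φ x ℚ.≤ φ x₀ + o
    upper x = begin
      φ x                  ≡⟨ back (φ x) (φ x₀) ⟩
      φ x₀ + (φ x - φ x₀)  ≤⟨ ℚₚ.+-monoʳ-≤ (φ x₀) (osc x x₀) ⟩
      φ x₀ + o             ∎
    above : rest v ℚ.≤ s * (φ x₀ + o)
    above = subst (λ a → rest v ℚ.≤ a * (φ x₀ + o)) (mass v)
      (weighted-≤ (excess v) φ (φ x₀ + o) (λ x → p≤q⇒0≤q-p (m≤ x)) upper)
    below : s * φ x₀ ℚ.≤ rest v′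
    below = subst (λ a → a * φ x₀ ℚ.≤ rest v′) (mass v′)
      (weighted-≥ (excess v′) φ (φ x₀) (λ x → p≤q⇒0≤q-p (m≤′ x)) min)

  osc-pulls : ∀ φ o → 0ℚ ℚ.≤ o → Osc φ o → ∀ j → Osc (pulls (j ℕ.* L) φ) (pow (1ℚ - c) j * o)
  osc-pulls φ o 0≤o osc zero v v′ = subst (φ v - φ v′ ℚ.≤_) (sym (ℚₚ.*-identityˡ o)) (osc v v′)
  osc-pulls φ o 0≤o osc (suc j) v v′ = subst₂ ℚ._≤_
    (cong₂ _-_ (sym (pulls-+ L (j ℕ.* L) φ v)) (sym (pulls-+ L (j ℕ.* L) φ v′)))
    (sym (ℚₚ.*-assoc (1ℚ - c) (pow (1ℚ - c) j) o))
    (osc-contract (pulls (j ℕ.* L) φ) (pow (1ℚ - c) j * o)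
      (0≤* (0≤pow (p≤q⇒0≤q-p c≤1) j) 0≤o) (osc-pulls φ o 0≤o osc j) v v′)

  signOf : ∀ {z} → Dec (0ℚ ℚ.≤ z) → ℚ
  signOf (yes _) = 1ℚ
  signOf (no _)  = - 1ℚ

  sign : ℚ → ℚ
  sign z = signOf (0ℚ ℚ.≤? z)

  ∣∣≡sign* : ∀ z → ∣ z ∣ ≡ sign z * z
  ∣∣≡sign* z = go (0ℚ ℚ.≤? z)
    where
    go : (d : Dec (0ℚ ℚ.≤ z)) → ∣ z ∣ ≡ signOf d * z
    go (yes 0≤z) = trans (ℚₚ.0≤p⇒∣p∣≡p 0≤z) (sym (ℚₚ.*-identityˡ z))
    go (no ¬0≤z) = trans (sym (ℚₚ.∣-p∣≡∣p∣ z)) (trans (ℚₚ.0≤p⇒∣p∣≡p (ℚₚ.neg-antimono-≤ (ℚₚ.<⇒≤ (ℚₚ.≰⇒> ¬0≤z))))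
                     (solve 1 (λ z → :- z := (:- con 1ℚ) :* z) refl z))

  sign-osc : ∀ z w → sign z - sign w ℚ.≤ 1ℚ + 1ℚ
  sign-osc z w = ℚₚ.+-mono-≤ (proj₂ (bounds (0ℚ ℚ.≤? z))) (ℚₚ.neg-antimono-≤ (proj₁ (bounds (0ℚ ℚ.≤? w))))
    where
    -1≤1 : - 1ℚ ℚ.≤ 1ℚ
    -1≤1 = toWitness {a? = - 1ℚ ℚ.≤? 1ℚ} _
    bounds : ∀ {z} (d : Dec (0ℚ ℚ.≤ z)) → - 1ℚ ℚ.≤ signOf d × signOf d ℚ.≤ 1ℚ
    bounds (yes _) = -1≤1 , ℚₚ.≤-refl
    bounds (no _)  = ℚₚ.≤-refl , -1≤1

  stationary-pulls : ∀ π → (∀ x → push π x ≡ π x) → ∀ t φ →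
                     sumℚ k (λ x → π x * pulls t φ x) ≡ sumℚ k (λ x → π x * φ x)
  stationary-pulls π st zero    φ = refl
  stationary-pulls π st (suc t) φ = trans (sym (dual π (pulls t φ)))
    (trans (sum-cong k (λ x → cong (_* pulls t φ x) (st x))) (stationary-pulls π st t φ))

  -- ∑ ∣μ − π∣ is tested against φ = sign (μ − π), whose oscillation is at most 2.
  mixing : ∀ π → (∀ x → 0ℚ ℚ.≤ π x) → sumℚ k π ≡ 1ℚ → (∀ x → push π x ≡ π x) → ∀ j v →
           ℚ.½ * sumℚ k (λ x → ∣ dist (j ℕ.* L) v x - π x ∣) ℚ.≤ pow (1ℚ - c) j
  mixing π π≥0 Σπ st j v = begin
    ℚ.½ * sumℚ k (λ x → ∣ dist t v x - π x ∣)
      ≡⟨ cong (ℚ.½ *_) (sum-cong k (λ x → trans (∣∣≡sign* (dist t v x - π x))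
           (solve 3 (λ s d p → s :* (d :- p) := d :* s :- p :* s) refl (φ x) (dist t v x) (π x)))) ⟩
    ℚ.½ * sumℚ k (λ x → dist t v x * φ x - π x * φ x)
      ≡⟨ cong (ℚ.½ *_) (trans (sum-- k _ _) (cong₂ _-_ (dist-pulls t v φ) (sym (stationary-pulls π st t φ)))) ⟩
    -- By stationarity `π` integrates `φ` and `ψ` alike, so what is left is the `π`-average of
    -- `ψ v - ψ x`, which the oscillation of `ψ` bounds.
    ℚ.½ * (ψ v - sumℚ k (λ x → π x * ψ x))
      ≡⟨ cong (ℚ.½ *_) (begin-equality
           ψ v - sumℚ k (λ x → π x * ψ x)
             ≡⟨ cong (_- sumℚ k (λ x → π x * ψ x)) (trans (sym (ℚₚ.*-identityˡ (ψ v))) (cong (_* ψ v) (sym Σπ))) ⟩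
           sumℚ k π * ψ v - sumℚ k (λ x → π x * ψ x)
             ≡⟨ cong (_- sumℚ k (λ x → π x * ψ x)) (sum-*ʳ k (ψ v) π) ⟨
           sumℚ k (λ x → π x * ψ v) - sumℚ k (λ x → π x * ψ x)
             ≡⟨ sum-- k _ _ ⟨
           sumℚ k (λ x → π x * ψ v - π x * ψ x)
             ≡⟨ sum-cong k (λ x → solve 3 (λ p a b → p :* a :- p :* b := p :* (a :- b)) refl (π x) (ψ v) (ψ x)) ⟩
           sumℚ k (λ x → π x * (ψ v - ψ x)) ∎) ⟩
    ℚ.½ * sumℚ k (λ x → π x * (ψ v - ψ x))
      ≤⟨ *-monoˡ (ℚₚ.nonNegative⁻¹ ℚ.½) (weighted-≤ π (λ x → ψ v - ψ x) o π≥0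
           (osc-pulls φ (1ℚ + 1ℚ) (0≤+ 0≤1 0≤1) (λ a b → sign-osc (dist t v a - π a) (dist t v b - π b)) j v)) ⟩
    ℚ.½ * (sumℚ k π * o)
      ≡⟨ cong (λ s → ℚ.½ * (s * o)) Σπ ⟩
    ℚ.½ * (1ℚ * o)
      ≡⟨ solve 1 (λ b → con ℚ.½ :* (con 1ℚ :* (b :* (con 1ℚ :+ con 1ℚ))) := b) refl (pow (1ℚ - c) j) ⟩
    pow (1ℚ - c) j ∎
    where
    open ℚₚ.≤-Reasoning
    t = j ℕ.* L
    φ ψ : Fin k → ℚ
    φ x = sign (dist t v x - π x)
    ψ = pulls t φ
    o = pow (1ℚ - c) j * (1ℚ + 1ℚ)

-- Bernoulli's inequality in a form without division. In the induction step,
-- `(1 - 1/B) * (B + 1 + j)` is at most `B + j`: the term `B * (1/B)` removes 1 and `(1 + j)/B` is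
-- dropped.
bernoulli : ∀ B → 1 ℕ.≤ B → ∀ j → pow (1ℚ - recip B) j * (⟦ B ⟧ + ⟦ j ⟧) ℚ.≤ ⟦ B ⟧
bernoulli B 1≤B zero = ℚₚ.≤-reflexive (solve 1 (λ b → con 1ℚ :* (b :+ con 0ℚ) := b) refl ⟦ B ⟧)
bernoulli B 1≤B (suc j) = begin
  (1ℚ - c) * pow (1ℚ - c) j * (⟦ B ⟧ + (1ℚ + ⟦ j ⟧))
    ≡⟨ solve 4 (λ c w b j → (con 1ℚ :- c) :* w :* (b :+ (con 1ℚ :+ j))
                := w :* ((b :+ (con 1ℚ :+ j)) :- (b :* c :+ (con 1ℚ :+ j) :* c))) refl c (pow (1ℚ - c) j) ⟦ B ⟧ ⟦ j ⟧ ⟩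
  pow (1ℚ - c) j * ((⟦ B ⟧ + (1ℚ + ⟦ j ⟧)) - (⟦ B ⟧ * c + (1ℚ + ⟦ j ⟧) * c))
    ≤⟨ *-monoˡ (0≤pow 0≤1-c j) (ℚₚ.+-monoʳ-≤ (⟦ B ⟧ + (1ℚ + ⟦ j ⟧)) (ℚₚ.neg-antimono-≤
         (ℚₚ.+-monoʳ-≤ (⟦ B ⟧ * c) (0≤* (0≤⟦⟧ (suc j)) (0≤recip B))))) ⟩
  pow (1ℚ - c) j * ((⟦ B ⟧ + (1ℚ + ⟦ j ⟧)) - (⟦ B ⟧ * c + 0ℚ))
    ≡⟨ cong (λ s → pow (1ℚ - c) j * ((⟦ B ⟧ + (1ℚ + ⟦ j ⟧)) - (s + 0ℚ))) (⟦⟧*recip 1≤B) ⟩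
  pow (1ℚ - c) j * ((⟦ B ⟧ + (1ℚ + ⟦ j ⟧)) - (1ℚ + 0ℚ))
    ≡⟨ solve 3 (λ w b j → w :* ((b :+ (con 1ℚ :+ j)) :- (con 1ℚ :+ con 0ℚ)) := w :* (b :+ j)) refl (pow (1ℚ - c) j) ⟦ B ⟧ ⟦ j ⟧ ⟩
  pow (1ℚ - c) j * (⟦ B ⟧ + ⟦ j ⟧)
    ≤⟨ bernoulli B 1≤B j ⟩
  ⟦ B ⟧ ∎
  where
  open ℚₚ.≤-Reasoning
  c = recip B
  0≤1-c : 0ℚ ℚ.≤ 1ℚ - c
  0≤1-c = p≤q⇒0≤q-p (recip-anti {1} (s≤s z≤n) 1≤B)

-- With `j = B * q`, discard the summand `B` of `B + B * q` and cancel the factor `B`.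
pow-small : ∀ B q → 1 ℕ.≤ B → 1 ℕ.≤ q → pow (1ℚ - recip B) (B ℕ.* q) ℚ.≤ recip q
pow-small B q 1≤B 1≤q = ≤-recip 1≤q (ℚₚ.*-cancelˡ-≤-pos ⟦ B ⟧ {{ℚ.positive 0<B}} (begin
  ⟦ B ⟧ * (⟦ q ⟧ * w)
    ≡⟨ solve 3 (λ b q w → b :* (q :* w) := w :* (con 0ℚ :+ b :* q)) refl ⟦ B ⟧ ⟦ q ⟧ w ⟩
  w * (0ℚ + ⟦ B ⟧ * ⟦ q ⟧)
    ≤⟨ *-monoˡ (0≤pow (p≤q⇒0≤q-p (recip-anti {1} (s≤s z≤n) 1≤B)) (B ℕ.* q)) (ℚₚ.+-monoˡ-≤ (⟦ B ⟧ * ⟦ q ⟧) (0≤⟦⟧ B)) ⟩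
  w * (⟦ B ⟧ + ⟦ B ⟧ * ⟦ q ⟧)
    ≡⟨ cong (λ s → w * (⟦ B ⟧ + s)) (⟦⟧-* B q) ⟨
  w * (⟦ B ⟧ + ⟦ B ℕ.* q ⟧)
    ≤⟨ bernoulli B 1≤B (B ℕ.* q) ⟩
  ⟦ B ⟧
    ≡⟨ ℚₚ.*-identityʳ ⟦ B ⟧ ⟨
  ⟦ B ⟧ * 1ℚ ∎))
  where
  open ℚₚ.≤-Reasoning
  w = pow (1ℚ - recip B) (B ℕ.* q)
  0<B : 0ℚ ℚ.< ⟦ B ⟧
  0<B = ℚₚ.<-≤-trans (ℚₚ.positive⁻¹ 1ℚ) (⟦⟧-mono 1≤B)

-- The denominator of `ε` serves as `q`, since the numerator is at least 1.
recip≤ε : ∀ ε → 0ℚ ℚ.< ε → ∃ λ q → 1 ℕ.≤ q × recip q ℚ.≤ ε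
recip≤ε ε@(mkℚ (ℤ.+ suc a) q-1 _) _ = suc q-1 , s≤s z≤n , ℚₚ.toℚᵘ-cancel-≤ (ℚᵘₚ.≤-respˡ-≃
  (ℚᵘₚ.≃-sym (ℚₚ.toℚᵘ-fromℚᵘ (mkℚᵘ (ℤ.+ 1) q-1)))
  (ℚᵘ.*≤* (ℤₚ.*-monoʳ-≤-nonNeg (ℤ.+ suc q-1) (ℤ.+≤+ {1} {suc a} (s≤s z≤n)))))
recip≤ε ε@(mkℚ (ℤ.+ zero) _ _) (ℚ.*<* (ℤ.+<+ ()))
recip≤ε ε@(mkℚ ℤ.-[1+ _ ] _ _) (ℚ.*<* ())

if-true : ∀ {A : Set} {b} {x y : A} → b ≡ true → (if b then x else y) ≡ x
if-true refl = refl

if-false : ∀ {A : Set} {b} {x y : A} → b ≡ false → (if b then x else y) ≡ y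
if-false refl = refl

bool-cases : ∀ b → b ≡ true ⊎ b ≡ false
bool-cases true  = inj₁ refl
bool-cases false = inj₂ refl

-- The transition kernel of the weighted walk and an invariant lower bound

module WalkKernel (Γ : FIGraph) (n : ℕ) where
  open Action Γ n
  open Orbits Γ n

  private
    k = V (G Γ n)
    A = adj (G Γ n)
    P = walkP Γ n

  weight : Vx → Vx → ℚ
  weight v w = recip (orbitsAt Γ n v) * recip (orbitDegree Γ n v w)

  0≤weight : ∀ v w → 0ℚ ℚ.≤ weight v w
  0≤weight v w = 0≤* (0≤recip (orbitsAt Γ n v)) (0≤recip (orbitDegree Γ n v w))

  0≤if : ∀ b {x} → 0ℚ ℚ.≤ x → 0ℚ ℚ.≤ (if b then x else 0ℚ)
  0≤if true  h = h
  0≤if false h = ℚₚ.≤-refl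

  0≤walkP : ∀ v w → 0ℚ ℚ.≤ P v w
  0≤walkP v w = 0≤if (A v w) (0≤weight v w)

  -- The edges at v are summed orbit by orbit, each orbit being indexed by its first neighbour u.
  private
    share : Vx → Vx → Vx → ℚ
    share v w u = if firstᵇ v u ∧ (A v w ∧ orbᵇ v w v u) then weight v u else 0ℚ

    share-const : ∀ v w → (∀ u → share v w u ≡ (if firstᵇ v u ∧ (A v w ∧ orbᵇ v w v u) then weight v w else 0ℚ))
    share-const v w u = go (bool-cases (firstᵇ v u ∧ (A v w ∧ orbᵇ v w v u)))
      where
      b = firstᵇ v u ∧ (A v w ∧ orbᵇ v w v u)
      go : b ≡ true ⊎ b ≡ false → (if b then weight v u else 0ℚ) ≡ (if b then weight v w else 0ℚ)
      go (inj₂ e) = trans (if-false e) (sym (if-false e))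
      go (inj₁ e) = trans (if-true e) (trans
        (cong (λ d → recip (orbitsAt Γ n v) * recip d) (sym (orbitDegree-cong
          (orbᵇ⇒ (proj₂ (∧-true {A v w} (proj₂ (∧-true {firstᵇ v u} e))))))))
        (sym (if-true e)))

    walkP≡shares : ∀ v w → P v w ≡ sumℚ k (share v w)
    walkP≡shares v w = sym (trans (sum-cong k (share-const v w)) (trans (sum-if k q (weight v w)) (go (bool-cases (A v w)))))
      where
      q : Vx → Bool
      q u = firstᵇ v u ∧ (A v w ∧ orbᵇ v w v u)
      q⇒ : ∀ {u} → q u ≡ true → First v u × A v w ≡ true × Orbit v w v u
      q⇒ {u} t = firstᵇ⇒ (proj₁ (∧-true {firstᵇ v u} t)) ,
                 proj₁ (∧-true {A v w} (proj₂ (∧-true {firstᵇ v u} t))) ,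
                 orbᵇ⇒ (proj₂ (∧-true {A v w} (proj₂ (∧-true {firstᵇ v u} t))))
      go : A v w ≡ true ⊎ A v w ≡ false → ⟦ count k q ⟧ * weight v w ≡ P v w
      go (inj₂ e) = trans (cong (λ c → ⟦ c ⟧ * weight v w) (count-none k λ u t →
          contradiction (trans (sym (proj₁ (proj₂ (q⇒ t)))) e) λ ()))
        (trans (ℚₚ.*-zeroˡ (weight v w)) (sym (if-false e)))
      go (inj₁ e) = trans (cong (λ c → ⟦ c ⟧ * weight v w) one)
        (trans (ℚₚ.*-identityˡ (weight v w)) (sym (if-true e)))
        where
        rep = first-exists e
        -- Exactly one first neighbour represents the orbit of the edge from `v` to `w`.
        one : count k q ≡ 1
        one = ℕₚ.≤-antisym
          (count-injective k 1 q (λ _ → zero) λ x y qx qy _ →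
            let fx , _ , ox = q⇒ qx ; fy , _ , oy = q⇒ qy in first-unique fx fy (orbit-trans (orbit-sym ox) oy))
          (count-pos k q (proj₁ rep) (∧-intro (⇒firstᵇ (proj₁ (proj₂ rep))) (∧-intro e (⇒orbᵇ (proj₂ (proj₂ rep))))))

    shares≡ : ∀ v u → sumℚ k (λ w → share v w u) ≡ (if firstᵇ v u then recip (orbitsAt Γ n v) else 0ℚ)
    shares≡ v u = trans (sum-if k (λ w → firstᵇ v u ∧ (A v w ∧ orbᵇ v w v u)) (weight v u)) (go (bool-cases (firstᵇ v u)))
      where
      D = orbitDegree Γ n v u
      a = recip (orbitsAt Γ n v)
      go : firstᵇ v u ≡ true ⊎ firstᵇ v u ≡ false →
           ⟦ count k (λ w → firstᵇ v u ∧ (A v w ∧ orbᵇ v w v u)) ⟧ * weight v u ≡ (if firstᵇ v u then a else 0ℚ)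
      go (inj₂ e) = trans (cong (λ c → ⟦ c ⟧ * weight v u) (count-none k λ w t →
          contradiction (trans (sym (proj₁ (∧-true {firstᵇ v u} t))) e) λ ()))
        (trans (ℚₚ.*-zeroˡ (weight v u)) (sym (if-false e)))
      go (inj₁ e) = begin
        ⟦ count k (λ w → firstᵇ v u ∧ (A v w ∧ orbᵇ v w v u)) ⟧ * (a * recip D)
          ≡⟨ cong (λ c → ⟦ c ⟧ * (a * recip D)) (trans (count-cong k λ w → cong (_∧ (A v w ∧ orbᵇ v w v u)) e) (sym (orbitDegree≡ v u))) ⟩
        ⟦ D ⟧ * (a * recip D)
          ≡⟨ solve 3 (λ d a r → d :* (a :* r) := a :* (d :* r)) refl ⟦ D ⟧ a (recip D) ⟩
        a * (⟦ D ⟧ * recip D)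
          ≡⟨ cong (a *_) (⟦⟧*recip (1≤orbitDegree (proj₁ (firstᵇ⇒ e)))) ⟩
        a * 1ℚ
          ≡⟨ ℚₚ.*-identityʳ a ⟩
        a
          ≡⟨ if-true e ⟨
        (if firstᵇ v u then a else 0ℚ) ∎
        where open ≡-Reasoning

  -- After exchanging the sums, each orbit contributes its degree times `weight`, that is
  -- `1 / orbitsAt`. The given edge excludes an isolated vertex, whose row is zero.
  row-sum : ∀ {v w} → Edge (G Γ n) v w → sumℚ k (P v) ≡ 1ℚ
  row-sum {v} e = begin
    sumℚ k (P v)
      ≡⟨ sum-cong k (walkP≡shares v) ⟩
    sumℚ k (λ w → sumℚ k (share v w))
      ≡⟨ sum-comm k k (share v) ⟩
    sumℚ k (λ u → sumℚ k (λ w → share v w u))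
      ≡⟨ sum-cong k (shares≡ v) ⟩
    sumℚ k (λ u → if firstᵇ v u then recip (orbitsAt Γ n v) else 0ℚ)
      ≡⟨ sum-if k (firstᵇ v) (recip (orbitsAt Γ n v)) ⟩
    ⟦ count k (firstᵇ v) ⟧ * recip (orbitsAt Γ n v)
      ≡⟨ cong (λ c → ⟦ c ⟧ * recip (orbitsAt Γ n v)) (orbitsAt≡ v) ⟨
    ⟦ orbitsAt Γ n v ⟧ * recip (orbitsAt Γ n v)
      ≡⟨ ⟦⟧*recip (1≤orbitsAt e) ⟩
    1ℚ ∎
    where open ≡-Reasoning

  distAfter≡dist : ∀ t v x → distAfter Γ n t v x ≡ Kernel.dist P t v x
  distAfter≡dist zero    v x = refl
  distAfter≡dist (suc t) v x = sum-cong k λ y → cong (_* P y x) (distAfter≡dist t v y)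

  -- Unlike orbitsAt, whose definition depends on the order of the vertices, this lower bound for the
  -- walk is visibly invariant under 𝔖ₙ.
  module Minor (K : ℕ) (orbits≤K : ∀ v → orbitsAt Γ n v ≤ K) where

    Q : Vx → Vx → ℚ
    Q v w = if A v w then recip K * recip (orbitDegree Γ n v w) else 0ℚ

    0≤Q : ∀ v w → 0ℚ ℚ.≤ Q v w
    0≤Q v w = 0≤if (A v w) (0≤* (0≤recip K) (0≤recip (orbitDegree Γ n v w)))

    Q≤P : ∀ v w → Q v w ℚ.≤ P v w
    Q≤P v w = go (bool-cases (A v w))
      where
      go : A v w ≡ true ⊎ A v w ≡ false → Q v w ℚ.≤ P v w
      go (inj₂ e) = ℚₚ.≤-reflexive (trans (if-false e) (sym (if-false e)))
      go (inj₁ e) = ℚₚ.≤-trans (ℚₚ.≤-reflexive (if-true e)) (ℚₚ.≤-trans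
        (*-monoʳ (0≤recip (orbitDegree Γ n v w)) (recip-anti (1≤orbitsAt e) (orbits≤K v)))
        (ℚₚ.≤-reflexive (sym (if-true e))))

    Q-act : ∀ σ v w → Q (act σ v) (act σ w) ≡ Q v w
    Q-act σ v w = cong₂ (λ b d → if b then recip K * recip d else 0ℚ) (adj-act σ v w) (orbitDegree-act σ v w)

    open Kernel Q

    dist-act : ∀ σ t v x → dist t (act σ v) (act σ x) ≡ dist t v x
    dist-act σ zero v x = cong (λ b → if b then 1ℚ else 0ℚ) (iff⇒≡
      (λ e → dec-true (x ≟ v) (perm-injective (actₚ σ) (does⇒ (act σ x ≟ act σ v) e)))
      (λ e → dec-true (act σ x ≟ act σ v) (cong (act σ) (does⇒ (x ≟ v) e))))
    dist-act σ (suc t) v x = trans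
      (sum-permute k (λ y → dist t (act σ v) y * Q y (act σ x)) (actₚ σ))
      (sum-cong k λ y → cong₂ _*_ (dist-act σ t v y) (Q-act σ y x))

    -- With `D` the degree of the edge orbit, at least `D / M` good neighbours are each reached with
    -- weight `1 / (K * D)`, and there `ψ` is at least `1 / c`; the product is `1 / (K * M * c)`.
    -- Bounds are kept in the form `1 ≤ p * m`, free of division.
    pull-step : ∀ {y z} ψ (c M : ℕ) (good : Vx → Bool) → (∀ x → 0ℚ ℚ.≤ ψ x) →
                1 ≤ K → Edge (G Γ n) y z →
                (∀ x → good x ≡ true → 1ℚ ℚ.≤ ψ x * ⟦ c ⟧) →
                orbitDegree Γ n y z ≤ M ℕ.* count k (λ u → (A y u ∧ orbᵇ y u y z) ∧ good u) →
                1ℚ ℚ.≤ pull ψ y * ⟦ K ℕ.* M ℕ.* c ⟧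
    pull-step {y} {z} ψ c M good 0≤ψ 1≤K yz h deg = begin
      1ℚ
        ≡⟨ ⟦⟧*recip (1≤orbitDegree yz) ⟨
      ⟦ D ⟧ * recip D
        ≤⟨ *-monoʳ (0≤recip D) (⟦⟧-mono deg) ⟩
      ⟦ M ℕ.* N ⟧ * recip D
        ≡⟨ cong (_* recip D) (⟦⟧-* M N) ⟩
      ⟦ M ⟧ * ⟦ N ⟧ * recip D
        ≡⟨ ℚₚ.*-identityˡ _ ⟨
      1ℚ * (⟦ M ⟧ * ⟦ N ⟧ * recip D)
        ≡⟨ cong (_* (⟦ M ⟧ * ⟦ N ⟧ * recip D)) (⟦⟧*recip 1≤K) ⟨
      ⟦ K ⟧ * recip K * (⟦ M ⟧ * ⟦ N ⟧ * recip D)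
        ≡⟨ regroup ⟦ K ⟧ (recip K) ⟦ M ⟧ ⟦ N ⟧ (recip D) ⟩
      ⟦ N ⟧ * (recip K * recip D) * (⟦ K ⟧ * ⟦ M ⟧)
        ≡⟨ cong (_* (⟦ K ⟧ * ⟦ M ⟧)) (sum-if k q (recip K * recip D)) ⟨
      sumℚ k (λ u → if q u then recip K * recip D else 0ℚ) * (⟦ K ⟧ * ⟦ M ⟧)
        ≤⟨ *-monoʳ (0≤* (0≤⟦⟧ K) (0≤⟦⟧ M)) (sum-mono k term) ⟩
      sumℚ k (λ u → Q y u * ψ u * ⟦ c ⟧) * (⟦ K ⟧ * ⟦ M ⟧)
        ≡⟨ cong (_* (⟦ K ⟧ * ⟦ M ⟧)) (sum-*ʳ k ⟦ c ⟧ (λ u → Q y u * ψ u)) ⟩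
      pull ψ y * ⟦ c ⟧ * (⟦ K ⟧ * ⟦ M ⟧)
        ≡⟨ ℚₚ.*-assoc (pull ψ y) ⟦ c ⟧ (⟦ K ⟧ * ⟦ M ⟧) ⟩
      pull ψ y * (⟦ c ⟧ * (⟦ K ⟧ * ⟦ M ⟧))
        ≡⟨ cong (pull ψ y *_) (trans (ℚₚ.*-comm ⟦ c ⟧ (⟦ K ⟧ * ⟦ M ⟧)) (trans (cong (_* ⟦ c ⟧) (sym (⟦⟧-* K M))) (sym (⟦⟧-* (K ℕ.* M) c)))) ⟩
      pull ψ y * ⟦ K ℕ.* M ℕ.* c ⟧ ∎
      where
      open ℚₚ.≤-Reasoning
      q : Vx → Bool
      q u = (A y u ∧ orbᵇ y u y z) ∧ good u
      D = orbitDegree Γ n y z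
      N = count k q
      regroup : ∀ k k′ m n d → k * k′ * (m * n * d) ≡ n * (k′ * d) * (k * m)
      regroup = solve 5 (λ k k′ m n d → k :* k′ :* (m :* n :* d) := n :* (k′ :* d) :* (k :* m)) refl
      term : ∀ u → (if q u then recip K * recip D else 0ℚ) ℚ.≤ Q y u * ψ u * ⟦ c ⟧
      term u = go (bool-cases (q u))
        where
        go : q u ≡ true ⊎ q u ≡ false → (if q u then recip K * recip D else 0ℚ) ℚ.≤ Q y u * ψ u * ⟦ c ⟧
        go (inj₂ e) = ℚₚ.≤-trans (ℚₚ.≤-reflexive (if-false e)) (0≤* (0≤* (0≤Q y u) (0≤ψ u)) (0≤⟦⟧ c))
        go (inj₁ e) = begin
          (if q u then recip K * recip D else 0ℚ)   ≡⟨ if-true e ⟩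
          recip K * recip D                         ≡⟨ trans (if-true {x = recip K * recip (orbitDegree Γ n y u)} yu)
                                                         (cong (λ d → recip K * recip d) (orbitDegree-cong same)) ⟨
          Q y u                                     ≡⟨ ℚₚ.*-identityʳ (Q y u) ⟨
          Q y u * 1ℚ                                ≤⟨ *-monoˡ (0≤Q y u) (h u (proj₂ (∧-true {A y u ∧ orbᵇ y u y z} e))) ⟩
          Q y u * (ψ u * ⟦ c ⟧)                     ≡⟨ ℚₚ.*-assoc (Q y u) (ψ u) ⟦ c ⟧ ⟨
          Q y u * ψ u * ⟦ c ⟧                       ∎
          where
          t = ∧-true {A y u} (proj₁ (∧-true {A y u ∧ orbᵇ y u y z} e))
          yu = proj₁ t
          same = orbᵇ⇒ (proj₂ t)

-- A common lower bound of two laws from a joint level set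

module _ {k : ℕ} (q q′ : Fin k → ℚ) where

  same? : ∀ x₀ x → Dec (q x ≡ q x₀ × q′ x ≡ q′ x₀)
  same? x₀ x = (q x ℚₚ.≟ q x₀) ×-dec (q′ x ℚₚ.≟ q′ x₀)

  -- A decidable stand-in for the set of translates of `x₀` supported off the two given supports:
  -- both laws are constant on those translates, so the joint level set contains them.
  level : Fin k → Fin k → ℚ
  level x₀ x = if does (same? x₀ x) then 1ℚ else 0ℚ

  level-1 : ∀ x₀ {x} → q x ≡ q x₀ × q′ x ≡ q′ x₀ → level x₀ x ≡ 1ℚ
  level-1 x₀ {x} s = if-true (dec-true (same? x₀ x) s)

  level-cases : ∀ x₀ x → (level x₀ x ≡ 1ℚ × q x ≡ q x₀ × q′ x ≡ q′ x₀) ⊎ level x₀ x ≡ 0ℚ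
  level-cases x₀ x with bool-cases (does (same? x₀ x))
  ... | inj₁ t = inj₁ (if-true t , does⇒ (same? x₀ x) t)
  ... | inj₂ f = inj₂ (if-false f)

  0≤level : ∀ x₀ x → 0ℚ ℚ.≤ level x₀ x
  0≤level x₀ x with level-cases x₀ x
  ... | inj₁ (e , _) = subst (0ℚ ℚ.≤_) (sym e) 0≤1
  ... | inj₂ e       = subst (0ℚ ℚ.≤_) (sym e) ℚₚ.≤-refl

-- Take the smaller of `q x₀` and `q′ x₀` on the level set and 0 elsewhere. Since `q` and `q′` are
-- constant there, its total is the smaller of their two masses on the level set.
levelMinorant : ∀ {k} (q q′ : Fin k → ℚ) → (∀ x → 0ℚ ℚ.≤ q x) → (∀ x → 0ℚ ℚ.≤ q′ x) → ∀ x₀ b →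
  1ℚ ℚ.≤ sumℚ k (λ x → q x * level q q′ x₀ x) * b → 1ℚ ℚ.≤ sumℚ k (λ x → q′ x * level q q′ x₀ x) * b →
  ∃ λ (m : Fin k → ℚ) → (∀ x → m x ℚ.≤ q x) × (∀ x → m x ℚ.≤ q′ x) × 1ℚ ℚ.≤ sumℚ k m * b
levelMinorant {k} q q′ 0≤q 0≤q′ x₀ b h h′ =
  (λ x → κ * φ x) , (λ x → below x (0≤q x) κ≤q (λ s → proj₁ s)) , (λ x → below x (0≤q′ x) κ≤q′ (λ s → proj₂ s)) , total
  where
  φ : Fin k → ℚ
  φ = level q q′ x₀
  κ : ℚ
  κ = q x₀ ℚ.⊓ q′ x₀
  κ≤q : κ ℚ.≤ q x₀
  κ≤q = ℚₚ.p⊓q≤p (q x₀) (q′ x₀)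
  κ≤q′ : κ ℚ.≤ q′ x₀
  κ≤q′ = ℚₚ.p⊓q≤q (q x₀) (q′ x₀)
  below : ∀ x {r r₀} → 0ℚ ℚ.≤ r → κ ℚ.≤ r₀ → (q x ≡ q x₀ × q′ x ≡ q′ x₀ → r ≡ r₀) → κ * φ x ℚ.≤ r
  below x {r} {r₀} 0≤r κ≤ eq with level-cases q q′ x₀ x
  ... | inj₁ (e , s) = subst (ℚ._≤ r) (sym (trans (cong (κ *_) e) (ℚₚ.*-identityʳ κ))) (subst (κ ℚ.≤_) (sym (eq s)) κ≤)
  ... | inj₂ e       = subst (ℚ._≤ r) (sym (trans (cong (κ *_) e) (ℚₚ.*-zeroʳ κ))) 0≤r
  weigh : ∀ x {r r₀} → (q x ≡ q x₀ × q′ x ≡ q′ x₀ → r ≡ r₀) → r * φ x ≡ r₀ * φ x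
  weigh x {r} {r₀} eq with level-cases q q′ x₀ x
  ... | inj₁ (_ , s) = cong (_* φ x) (eq s)
  ... | inj₂ e       = trans (cong (r *_) e) (trans (ℚₚ.*-zeroʳ r) (sym (trans (cong (r₀ *_) e) (ℚₚ.*-zeroʳ r₀))))
  total : 1ℚ ℚ.≤ sumℚ k (λ x → κ * φ x) * b
  total with ℚₚ.≤-total (q x₀) (q′ x₀)
  ... | inj₁ le = subst (λ s → 1ℚ ℚ.≤ s * b) (sum-cong k λ x →
          trans (weigh x (λ s → proj₁ s)) (cong (_* φ x) (sym (ℚₚ.p≤q⇒p⊓q≡p le)))) h
  ... | inj₂ ge = subst (λ s → 1ℚ ℚ.≤ s * b) (sum-cong k λ x →
          trans (weigh x (λ s → proj₂ s)) (cong (_* φ x) (sym (ℚₚ.p≥q⇒p⊓q≡q ge)))) h′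

-- Overlap and mixing at a fixed large level `n`

module AtLevel (Γ : FIGraph) (d : ℕ)
  (gen : ∀ n → d ≤ n → ∀ (v : Fin (V (G Γ (suc n)))) →
         ∃ λ (f : Fin n → Fin (suc n)) → Σ (Inj f) λ inj → ∃ λ u → map Γ f inj u ≡ v)
  (N : ℕ) (2d≤N : d ℕ.+ d ≤ N) (L : ℕ) (walks : ∀ a b → Walk (G Γ N) (suc L) a b)
  (n : ℕ) (N≤n : N ≤ n) (large : suc d ℕ.+ (d ℕ.+ (d ℕ.+ d)) ≤ n) where

  open Presentation Γ d gen
  open Action Γ n
  open Orbits Γ n
  open WalkKernel Γ n

  private
    k = V (G Γ n)

  -- In each step `1 / K` bounds the chance of the prescribed edge orbit and `1 / M` the share of
  -- good neighbours in it; the exponent `d + d` is the size of two supports. None of the three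
  -- depends on `n`.
  K M B : ℕ
  K = V (G Γ N) ℕ.* V (G Γ N)
  M = 2 ℕ.* (d ℕ.^ d ℕ.* (2 ℕ.+ d) ℕ.^ (d ℕ.+ d))
  B = (K ℕ.* M) ℕ.^ suc L

  orbits≤K : ∀ v → orbitsAt Γ n v ≤ K
  orbits≤K = orbitsAt≤ (presentPair 2d≤N (ℕₚ.≤⇒≤′ N≤n))

  open Minor K orbits≤K
  open Kernel Q
  open Kernel.Nonneg Q 0≤Q

  d≤n : d ≤ n
  d≤n = ℕₚ.≤-trans (ℕₚ.m≤m+n d d) (ℕₚ.≤-trans 2d≤N N≤n)

  2d<n : d ℕ.+ d < n
  2d<n = ℕₚ.≤-trans (s≤s (ℕₚ.+-monoʳ-≤ d (ℕₚ.m≤m+n d (d ℕ.+ d)))) large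

  exactWalk : ∀ v w → Walk (G Γ n) (suc L) v w
  exactWalk v w with presentPair 2d≤N (ℕₚ.≤⇒≤′ N≤n) v w
  ... | g , inj , a , b , refl , refl = mapWalk (map Γ g inj) (map-hom Γ g inj) (walks a b)

  neighbour : ∀ v → ∃ λ w → Edge (G Γ n) v w
  neighbour v with exactWalk v v
  ... | e ∷ _ = _ , e

  1≤K : Vx → 1 ≤ K
  1≤K v = ℕₚ.≤-trans (1≤orbitsAt (proj₂ (neighbour v))) (orbits≤K v)

  supported : ∀ {m} (e : Fin m → Fin n) (inj : Inj e) u σ → (∀ i → σ ⟨$⟩ʳ e i ≡ e i) →
              act σ (map Γ e inj u) ≡ map Γ e inj u
  supported e inj u σ fix = act-map σ inj inj fix u

  -- Follow a walk to a vertex whose support avoids xs: a positive proportion of the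
  -- neighbours in the orbit of its first edge still begin such a walk.
  avoiding : ∀ (xs : List (Fin n)) → length xs ≡ d ℕ.+ d → (φ : Vx → ℚ) → (∀ x → 0ℚ ℚ.≤ φ x) →
             ∀ u → (∀ (f : Fin d → Fin n) (inj : Inj f) → (∀ i → f i ∉ xs) → 1ℚ ℚ.≤ φ (map Γ f inj u)) →
             ∀ l {y x} → Walk (G Γ n) l y x →
             ∀ (f : Fin d → Fin n) (inj : Inj f) → (∀ i → f i ∉ xs) → map Γ f inj u ≡ x →
             1ℚ ℚ.≤ pulls l φ y * ⟦ (K ℕ.* M) ℕ.^ l ⟧
  avoiding xs len φ 0≤φ u h zero [] f inj f∉ refl =
    ℚₚ.≤-trans (h f inj f∉) (ℚₚ.≤-reflexive (sym (ℚₚ.*-identityʳ (φ (map Γ f inj u)))))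
  avoiding xs len φ 0≤φ u h (suc l) {y} {x} (_∷_ {w = z} yz p) f inj f∉ eq =
    pull-step (pulls l φ) c M good (0≤pulls 0≤φ l) (1≤K y) yz
      (λ w t → does⇒ (1ℚ ℚ.≤? pulls l φ w * ⟦ c ⟧) t)
      (subst (λ s → orbitDegree Γ n y z ≤ 2 ℕ.* (d ℕ.^ d ℕ.* (2 ℕ.+ d) ℕ.^ s) ℕ.*
                      count k (λ u → (adj (G Γ n) y u ∧ orbᵇ y u y z) ∧ good u)) len
        (Core.orbitDegree≤good y d (proj₁ rep) supp 2d<n xs f f∉
          (subst (λ s → suc d ℕ.+ (d ℕ.+ s) ≤ n) (sym len) large) z yz good still-good))
    where
    c = (K ℕ.* M) ℕ.^ l
    rep = present (ℕₚ.≤⇒≤′ d≤n) y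
    supp : ∀ σ → (∀ i → σ ⟨$⟩ʳ proj₁ rep i ≡ proj₁ rep i) → act σ y ≡ y
    supp σ fix = subst (λ v → act σ v ≡ v) (proj₂ (proj₂ (proj₂ rep)))
      (supported (proj₁ rep) (proj₁ (proj₂ rep)) (proj₁ (proj₂ (proj₂ rep))) σ fix)
    -- Goodness of `w` is the bound itself for the remaining `l` steps. For a translate of `z` by
    -- `σ` it follows by induction along the translated tail of the walk, whose end has support
    -- `σ ∘ f`.
    good : Vx → Bool
    good w = does (1ℚ ℚ.≤? pulls l φ w * ⟦ c ⟧)
    still-good : ∀ σ → (∀ i → σ ⟨$⟩ʳ f i ∉ xs) → good (act σ z) ≡ true
    still-good σ σf∉ = dec-true (1ℚ ℚ.≤? pulls l φ (act σ z) * ⟦ c ⟧)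
      (avoiding xs len φ 0≤φ u h l (mapWalk (act σ) (map-hom Γ _ (perm-injective σ)) p)
        (λ i → σ ⟨$⟩ʳ f i) (inj ∘ perm-injective σ) σf∉
        (trans (sym (act-map σ inj (inj ∘ perm-injective σ) (λ _ → refl) u)) (cong (act σ) eq)))

  Presented₁ : Vx → Set
  Presented₁ v = ∃ λ (e : Fin d → Fin n) → Σ (Inj e) λ inj → ∃ λ u → map Γ e inj u ≡ v

  -- The laws of both walks are constant on the vertices of one type whose support avoids those of
  -- v and v′: these form a single orbit under the permutations fixing v and v′.
  common : ∀ {v v′} → Presented₁ v → Presented₁ v′ →
           ∃ λ (m : Vx → ℚ) → (∀ x → m x ℚ.≤ dist (suc L) v x) × (∀ x → m x ℚ.≤ dist (suc L) v′ x) ×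
             1ℚ ℚ.≤ sumℚ k m * ⟦ B ⟧
  common {v} {v′} (e , e-inj , u , ev) (e′ , e′-inj , u′ , ev′) =
    levelMinorant q q′ (0≤dist (suc L) v) (0≤dist (suc L) v′) x₀ ⟦ B ⟧ (mass v) (mass v′)
    where
    xs = List.tabulate e ++ List.tabulate e′
    len : length xs ≡ d ℕ.+ d
    len = trans (List.length-++ (List.tabulate e)) (cong₂ ℕ._+_ (List.length-tabulate e) (List.length-tabulate e′))
    fr = freshInjection d xs (subst (λ s → d ℕ.+ s ≤ n) (sym len)
           (ℕₚ.≤-trans (ℕₚ.m≤n⇒m≤1+n (ℕₚ.+-monoʳ-≤ d (ℕₚ.m≤n+m (d ℕ.+ d) d))) large))
    f = proj₁ fr
    f-inj : Inj f
    f-inj = proj₁ (proj₂ fr)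
    f∉ : ∀ i → f i ∉ xs
    f∉ = proj₂ (proj₂ fr)
    -- The target is a translate of `v` itself, with the same generator `u`, placed off both
    -- supports.
    x₀ = map Γ f f-inj u
    q q′ : Vx → ℚ
    q  = dist (suc L) v
    q′ = dist (suc L) v′
    constant : ∀ (g : Fin d → Fin n) (inj : Inj g) → (∀ i → g i ∉ xs) →
               q (map Γ g inj u) ≡ q x₀ × q′ (map Γ g inj u) ≡ q′ x₀
    constant g inj g∉ = at fixed , at fixed′
      where
      -- `σ` takes `f` to `g` and moves nothing off their images; both images avoid `xs`, so `σ`
      -- fixes `v` and `v′`.
      ext = extend d f g f-inj inj
      σ = proj₁ ext
      fix : ∀ {x} → x ∈ xs → σ ⟨$⟩ʳ x ≡ x
      fix {x} x∈ = proj₂ (proj₂ ext) x (λ i eq → f∉ i (subst (_∈ xs) (sym eq) x∈))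
                                       (λ i eq → g∉ i (subst (_∈ xs) (sym eq) x∈))
      fixed : act σ v ≡ v
      fixed = subst (λ w → act σ w ≡ w) ev (supported e e-inj u σ λ i → fix (∈-++⁺ˡ (∈-tabulate⁺ i)))
      fixed′ : act σ v′ ≡ v′
      fixed′ = subst (λ w → act σ w ≡ w) ev′
        (supported e′ e′-inj u′ σ λ i → fix (∈-++⁺ʳ (List.tabulate e) (∈-tabulate⁺ i)))
      at : ∀ {w} → act σ w ≡ w → dist (suc L) w (map Γ g inj u) ≡ dist (suc L) w x₀
      at {w} fw = trans (cong₂ (dist (suc L)) (sym fw) (sym (act-map σ f-inj inj (proj₁ (proj₂ ext)) u)))
                        (dist-act σ (suc L) w x₀)
    mass : ∀ w → 1ℚ ℚ.≤ sumℚ k (λ x → dist (suc L) w x * level q q′ x₀ x) * ⟦ B ⟧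
    mass w = subst (λ s → 1ℚ ℚ.≤ s * ⟦ B ⟧) (sym (dist-pulls (suc L) w (level q q′ x₀)))
      (avoiding xs len (level q q′ x₀) (0≤level q q′ x₀) u
        (λ g inj g∉ → ℚₚ.≤-reflexive (sym (level-1 q q′ x₀ (constant g inj g∉))))
        (suc L) (exactWalk w x₀) f f-inj f∉ refl)

  1≤M : 1 ≤ M
  1≤M = ℕₚ.*-mono-≤ {1} {2} (s≤s z≤n) (ℕₚ.*-mono-≤ (1≤d^d d) (ℕₚ.m^n>0 (2 ℕ.+ d) (d ℕ.+ d)))
    where
    1≤d^d : ∀ d → 1 ≤ d ℕ.^ d
    1≤d^d zero    = s≤s z≤n
    1≤d^d (suc d) = ℕₚ.m^n>0 (suc d) (suc d)

  1≤B : Vx → 1 ≤ B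
  1≤B v = ℕₚ.m^n>0 (K ℕ.* M) {{ℕ.>-nonZero (ℕₚ.*-mono-≤ (1≤K v) 1≤M)}} (suc L)

  minorant : Vx → ∀ v v′ → ∃ λ (m : Vx → ℚ) → (∀ x → m x ℚ.≤ Kernel.dist (walkP Γ n) (suc L) v x) ×
               (∀ x → m x ℚ.≤ Kernel.dist (walkP Γ n) (suc L) v′ x) × recip B ℚ.≤ sumℚ k m
  minorant v₀ v v′ = proj₁ c
    , (λ x → ℚₚ.≤-trans (proj₁ (proj₂ c) x) (dist-mono 0≤Q Q≤P (suc L) v x))
    , (λ x → ℚₚ.≤-trans (proj₁ (proj₂ (proj₂ c)) x) (dist-mono 0≤Q Q≤P (suc L) v′ x))
    , recip-≤ (1≤B v₀) (proj₂ (proj₂ (proj₂ c)))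
    where c = common (present (ℕₚ.≤⇒≤′ d≤n) v) (present (ℕₚ.≤⇒≤′ d≤n) v′)

  mixed : ∀ q → 1 ≤ q → ∀ π → Stationary Γ n π → ∀ v →
          tvDist Γ n (distAfter Γ n (B ℕ.* q ℕ.* suc L) v) π ℚ.≤ recip q
  mixed q 1≤q π (0≤π , Σπ , st) v = ℚₚ.≤-trans
    (ℚₚ.≤-trans
      (ℚₚ.≤-reflexive (cong (ℚ.½ *_) (sum-cong k λ x → cong (λ p → ∣ p - π x ∣) (distAfter≡dist (B ℕ.* q ℕ.* suc L) v x))))
      (Contraction.mixing (walkP Γ n) 0≤walkP (λ y → row-sum (proj₂ (neighbour y))) (suc L) (recip B)
        (recip-anti {1} (s≤s z≤n) (1≤B v)) (minorant v) π 0≤π Σπ st (B ℕ.* q) v))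
    (pow-small B q (1≤B v) 1≤q)

theorem3p15 : (Γ : FIGraph) → FinitelyGenerated Γ →
    (∀ n → Connected (G Γ n)) →
    (∃ λ N₀ → ∀ n → N₀ ≤ n → ¬ Bipartite (G Γ n)) →
    ∀ (ε : ℚ) → 0ℚ Data.Rational.< ε →
    ∃ λ (T : ℕ) → ∃ λ (N : ℕ) → ∀ n → N < n →
    ∀ π → Stationary Γ n π → MixingTimeAtMost Γ n ε π T
theorem3p15 Γ (d , gen) connected (N₀ , nonBipartite) ε 0<ε = T , N ℕ.+ D , bound
  where
  -- At least `2d`, so that pairs of vertices are presented at level `N`, and at least `N₀`, so that
  -- the graph there is not bipartite.
  N = d ℕ.+ (d ℕ.⊔ N₀)
  -- Room for `d + 1` spare points, the support of the current vertex and the supports of the two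
  -- starting vertices.
  D = suc d ℕ.+ (d ℕ.+ (d ℕ.+ d))
  2d≤N : d ℕ.+ d ≤ N
  2d≤N = ℕₚ.+-monoʳ-≤ d (ℕₚ.m≤m⊔n d N₀)
  N₀≤N : N₀ ≤ N
  N₀≤N = ℕₚ.≤-trans (ℕₚ.m≤n⊔m d N₀) (ℕₚ.m≤n+m (d ℕ.⊔ N₀) d)
  exact = exactWalks (G Γ N) (connected N) (nonBipartite N N₀≤N)
  small = recip≤ε ε 0<ε
  L = proj₁ exact
  q = proj₁ small
  -- This is `B * q` rounds of `suc L` steps each, with `B` written out to show that it is free of
  -- `n`.
  T = ((V (G Γ N) ℕ.* V (G Γ N)) ℕ.* (2 ℕ.* (d ℕ.^ d ℕ.* (2 ℕ.+ d) ℕ.^ (d ℕ.+ d)))) ℕ.^ suc L ℕ.* q ℕ.* suc L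
  bound : ∀ n → N ℕ.+ D < n → ∀ π → Stationary Γ n π → MixingTimeAtMost Γ n ε π T
  bound n lt π st = T , ℕₚ.≤-refl , λ v → ℚₚ.≤-trans
    (AtLevel.mixed Γ d gen N 2d≤N L (proj₂ exact) n
      (ℕₚ.≤-trans (ℕₚ.m≤m+n N D) (ℕₚ.<⇒≤ lt)) (ℕₚ.≤-trans (ℕₚ.m≤n+m D N) (ℕₚ.<⇒≤ lt))
      q (proj₁ (proj₂ small)) π st v)
    (proj₂ (proj₂ small))
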